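{- The problems Steiner Tree and Connected Dominating Set can both be solved in polynomial time when restricted to input graphs that are undirected path graphs of diameter at most $2$.
   Context: All graphs are finite, simple and undirected. A tree model of a graph $G$ is a pair $(T,\{T_u\}_{u\in V(G)})$ where $T$ is a tree and each $T_u$ is a (non-empty) subtree of $T$ such that, for all distinct $u,v\in V(G)$, $uv\in E(G)$ if and only if $V(T_u)\cap V(T_v)\neq\emptyset$. An undirected path graph is a graph that has a tree model in which every $T_u$ is a subpath of $T$. Steiner Tree is the following decision problem. Input: a connected graph $G$, a non-empty subset $X\subseteq V(G)$ (the terminals), and a positive integer $k$. Question: does there exist a subset $S\subseteq V(G)\setminus X$ with $|S|\le k$ such that the induced subgraph $G[S\cup X]$ is connected? Connected Dominating Set is the following decision problem. Input: a graph $G$ and a positive integer $k$. Question: does there exist $D\subseteq V(G)$ with $|D|\le k$ such that $N_G[D]=V(G)$ (where $N_G[D]$ is the set of vertices that are in $D$ or have a neighbor in $D$) and the induced subgraph $G[D]$ is connected? -}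

module Defs where

open import Data.Bool.Base using (Bool; true; false; T)
open import Data.Fin.Base using (Fin; zero; suc)
open import Data.Fin.Subset using (Subset; _∈_; _⊆_; _∩_; _∪_; ∁; ∣_∣; Nonempty)
open import Data.List.Base using (List; []; _∷_; [_]; _++_; foldr; tabulate) renaming (length to ∣_∣ₗ)
import Data.List.Membership.Propositional as List
open import Data.List.Relation.Unary.Linked using (Linked)
open import Data.List.Relation.Unary.Unique.Propositional using (Unique)
open import Data.Nat.Base using (ℕ; zero; suc; _+_; _*_; _^_; _≤_; NonZero)
open import Data.Nat.Binary.Base using (ℕᵇ; zero; 2[1+_]; 1+[2_]; fromℕ)
open import Data.Product.Base using (Σ; ∃; ∃-syntax; _×_; proj₁)
open import Data.Sum.Base using (_⊎_)
open import Data.Vec.Base using (Vec; _∷_; lookup; replicate; toList; _[_]≔_)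
open import Function.Base using (_∘_)
open import Function.Bundles using (_⇔_)
open import Relation.Binary.Construct.Closure.ReflexiveTransitive using (Star; fold)
open import Relation.Binary.PropositionalEquality.Core using (_≡_; _≢_)
open import Relation.Nullary using (¬_; Reflects)

------------------------------------------------------------------------
-- Graphs

record Graph : Set where
  field
    order  : ℕ
    adj    : Fin order → Fin order → Bool
    sym    : ∀ u v → adj u v ≡ adj v u
    irrefl : ∀ u → adj u u ≡ false

  V : Set
  V = Fin order

  Adj : V → V → Set
  Adj u v = T (adj u v)

  Walk : V → V → Set
  Walk = Star Adj

  walkLength : ∀ {u v} → Walk u v → ℕ
  walkLength = fold (λ _ _ → ℕ) (λ _ ℓ → suc ℓ) 0

  Connected : Set
  Connected = ∀ u v → Walk u v

  -- Adjacency in the subgraph induced by U.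
  AdjIn : Subset order → V → V → Set
  AdjIn U u v = u ∈ U × v ∈ U × Adj u v

  InducedConnected : Subset order → Set
  InducedConnected U = ∀ {u v} → u ∈ U → v ∈ U → Star (AdjIn U) u v

  IsDistance : V → V → ℕ → Set
  IsDistance u v d =
    (∃[ w ] walkLength {u} {v} w ≡ d) × (∀ (w : Walk u v) → d ≤ walkLength w)

  -- In a disconnected graph some pairs of vertices have no distance, so
  -- its diameter is not bounded by any k.
  DiameterAtMost : ℕ → Set
  DiameterAtMost k = ∀ u v → ∃[ d ] (IsDistance u v d × d ≤ k)

  IsPath : List V → Set
  IsPath p = Linked Adj p × Unique p

  -- The cycle visiting v, then the vertices of p, then returning to v.
  IsCycle : V → List V → Set
  IsCycle v p = Linked Adj (v ∷ p ++ [ v ]) × Unique (v ∷ p) × 2 ≤ ∣ p ∣ₗ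

  IsTree : Set
  IsTree = Connected × (∀ v p → ¬ IsCycle v p)

  -- Connected subgraphs of a tree are induced subgraphs, so subtrees
  -- are given by their vertex sets.
  IsSubtree : Subset order → Set
  IsSubtree U = Nonempty U × InducedConnected U

  IsSubpath : Subset order → Set
  IsSubpath U = ∃[ p ] (IsPath p × (∀ x → x ∈ U ⇔ x List.∈ p))

record TreeModel (G : Graph) : Set where
  module G = Graph G
  field
    tree : Graph
  module T = Graph tree
  field
    isTree    : T.IsTree
    subtree   : G.V → Subset T.order
    isSubtree : ∀ u → T.IsSubtree (subtree u)
    adjacent  : ∀ {u v} → u ≢ v → G.Adj u v ⇔ Nonempty (subtree u ∩ subtree v)

UndirectedPathGraph : Graph → Set
UndirectedPathGraph G =
  Σ (TreeModel G) λ M → let open TreeModel M in ∀ u → T.IsSubpath (subtree u)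

------------------------------------------------------------------------
-- The WHILE language of N. D. Jones, "Computability and Complexity from
-- a Programming Perspective" (1997), over binary trees.  With the
-- running time defined below it decides in polynomial time exactly the
-- problems decided in polynomial time by Turing machines: values can be
-- stored as pointers into a shared heap, so each unit of time costs a
-- constant number of pointer operations.

infixr 5 _∙_

data 𝔻 : Set where
  nil : 𝔻
  _∙_ : 𝔻 → 𝔻 → 𝔻

size : 𝔻 → ℕ
size nil     = 1
size (a ∙ b) = suc (size a + size b)

head tail : 𝔻 → 𝔻
head nil     = nil
head (a ∙ b) = a
tail nil     = nil
tail (a ∙ b) = b

data Expr (n : ℕ) : Set where
  var   : Fin n → Expr n
  nil   : Expr n
  cons  : Expr n → Expr n → Expr n
  hd tl : Expr n → Expr n

infix  7 _≔_
infixr 6 _⨾_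

data Cmd (n : ℕ) : Set where
  _≔_           : Fin n → Expr n → Cmd n
  _⨾_           : Cmd n → Cmd n → Cmd n
  if_then_else_ : Expr n → Cmd n → Cmd n → Cmd n
  while_loop_   : Expr n → Cmd n → Cmd n

Store : ℕ → Set
Store n = Vec 𝔻 n

eval : ∀ {n} → Expr n → Store n → 𝔻
eval (var x)    σ = lookup σ x
eval nil        σ = nil
eval (cons e f) σ = eval e σ ∙ eval f σ
eval (hd e)     σ = head (eval e σ)
eval (tl e)     σ = tail (eval e σ)

cost : ∀ {n} → Expr n → ℕ
cost (var x)    = 1
cost nil        = 1
cost (cons e f) = suc (cost e + cost f)
cost (hd e)     = suc (cost e)
cost (tl e)     = suc (cost e)

private
  variable
    n t t′   : ℕ
    x        : Fin n
    e        : Expr n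
    c d      : Cmd n
    σ σ′ σ″  : Store n
    a b      : 𝔻

-- ⟨ c , σ ⟩⇓ σ′ [ t ]: from store σ, the command c halts in store σ′
-- after t units of time.
infix 4 ⟨_,_⟩⇓_[_]

data ⟨_,_⟩⇓_[_] {n : ℕ} : Cmd n → Store n → Store n → ℕ → Set where
  assign     : ⟨ x ≔ e , σ ⟩⇓ σ [ x ]≔ eval e σ [ suc (cost e) ]
  seq        : ⟨ c , σ ⟩⇓ σ′ [ t ] → ⟨ d , σ′ ⟩⇓ σ″ [ t′ ] →
               ⟨ c ⨾ d , σ ⟩⇓ σ″ [ suc (t + t′) ]
  if-true    : eval e σ ≡ a ∙ b → ⟨ c , σ ⟩⇓ σ′ [ t ] →
               ⟨ if e then c else d , σ ⟩⇓ σ′ [ suc (cost e + t) ]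
  if-false   : eval e σ ≡ nil → ⟨ d , σ ⟩⇓ σ′ [ t ] →
               ⟨ if e then c else d , σ ⟩⇓ σ′ [ suc (cost e + t) ]
  while-stop : eval e σ ≡ nil →
               ⟨ while e loop c , σ ⟩⇓ σ [ suc (cost e) ]
  while-step : eval e σ ≡ a ∙ b → ⟨ c , σ ⟩⇓ σ′ [ t ] →
               ⟨ while e loop c , σ′ ⟩⇓ σ″ [ t′ ] →
               ⟨ while e loop c , σ ⟩⇓ σ″ [ suc (cost e + t + t′) ]

-- A program is a command whose variable 0 holds the input initially and
-- the output finally; the other variables are initially nil.
record Program : Set where
  constructor program
  field
    {auxiliaries} : ℕ
    body          : Cmd (suc auxiliaries)

Computes_⟨_⟩↦_within_ : Program → 𝔻 → 𝔻 → ℕ → Set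
Computes program {m} c ⟨ input ⟩↦ output within bound =
  Σ (Store (suc m)) λ σ → ∃[ t ]
    (⟨ c , input ∷ replicate m nil ⟩⇓ σ [ t ] × lookup σ zero ≡ output × t ≤ bound)

------------------------------------------------------------------------
-- Decision problems and polynomial time

encodeBool : Bool → 𝔻
encodeBool false = nil
encodeBool true  = nil ∙ nil

encodeList : {A : Set} → (A → 𝔻) → List A → 𝔻
encodeList enc = foldr (λ a → enc a ∙_) nil

encodeSubset : Subset n → 𝔻
encodeSubset U = encodeList encodeBool (toList U)

-- Bijective base-2 digits, least significant first: the size of the
-- encoding is logarithmic in the number.
encodeℕᵇ : ℕᵇ → 𝔻
encodeℕᵇ zero     = nil
encodeℕᵇ 2[1+ k ] = encodeBool true ∙ encodeℕᵇ k
encodeℕᵇ 1+[2 k ] = encodeBool false ∙ encodeℕᵇ k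

encodeℕ : ℕ → 𝔻
encodeℕ = encodeℕᵇ ∘ fromℕ

-- The rows of the adjacency matrix.
encodeGraph : Graph → 𝔻
encodeGraph G =
  encodeList (encodeList encodeBool) (tabulate λ u → tabulate λ v → adj u v)
  where open Graph G

record DecisionProblem : Set₁ where
  field
    Instance : Set
    encode   : Instance → 𝔻
    Yes      : Instance → Set

-- The time bound c · size ^ d is as general as an arbitrary polynomial,
-- since sizes are positive.
PolynomialTime : DecisionProblem → Set
PolynomialTime P =
  ∃[ p ] ∃[ c ] ∃[ d ] ∀ (I : Instance) →
    ∃[ answer ] (Reflects (Yes I) answer ×
      Computes p ⟨ encode I ⟩↦ encodeBool answer within (c * size (encode I) ^ d))
  where open DecisionProblem P

record GraphProblem : Set₁ where
  field
    problem : DecisionProblem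
  open DecisionProblem problem public
  field
    graph   : Instance → Graph

infix 5 _restrictedTo_

_restrictedTo_ : GraphProblem → (Graph → Set) → DecisionProblem
P restrictedTo C = record
  { Instance = Σ Instance (C ∘ graph)
  ; encode   = encode ∘ proj₁
  ; Yes      = Yes ∘ proj₁
  } where open GraphProblem P

------------------------------------------------------------------------
-- Steiner Tree

record SteinerTreeInstance : Set where
  field
    G         : Graph
  open Graph G public
  field
    connected : Connected
    X         : Subset order
    nonempty  : Nonempty X
    k         : ℕ
    positive  : NonZero k

SteinerTree : GraphProblem
SteinerTree = record
  { problem = record
    { Instance = SteinerTreeInstance
    ; encode   = λ I → let open SteinerTreeInstance I in
                   encodeGraph G ∙ encodeSubset X ∙ encodeℕ k
    ; Yes      = λ I → let open SteinerTreeInstance I in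
                   ∃[ S ] (S ⊆ ∁ X × ∣ S ∣ ≤ k × InducedConnected (S ∪ X))
    }
  ; graph = SteinerTreeInstance.G
  }

------------------------------------------------------------------------
-- Connected Dominating Set

record ConnectedDominatingSetInstance : Set where
  field
    G        : Graph
  open Graph G public
  field
    k        : ℕ
    positive : NonZero k

  Dominating : Subset order → Set
  Dominating D = ∀ v → v ∈ D ⊎ ∃[ u ] (u ∈ D × Adj v u)

ConnectedDominatingSet : GraphProblem
ConnectedDominatingSet = record
  { problem = record
    { Instance = ConnectedDominatingSetInstance
    ; encode   = λ I → let open ConnectedDominatingSetInstance I in
                   encodeGraph G ∙ encodeℕ k
    ; Yes      = λ I → let open ConnectedDominatingSetInstance I in
                   ∃[ D ] (∣ D ∣ ≤ k × Dominating D × InducedConnected D)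
    }
  ; graph = ConnectedDominatingSetInstance.G
  }

{-# OPTIONS --safe #-}

-- Fix a path model in a tree and a family of connected objects in it: the
-- vertex paths for domination, the unions of the paths of the components
-- of G[X] for Steiner trees.  Shrink the tree to a subtree H that is minimal
-- among those meeting every object, so that each leaf of H has an object
-- of its own.  A path contains at most two leaves.  Since the diameter is at
-- most 2, some vertex meets the objects of any two leaves, and its path then
-- contains everything between them.  Hence
--   * the inclusion-maximal sets of objects met by a vertex correspond to
--     the pairs of leaves, so their number m = L (L - 1) / 2 determines the
--     number L of leaves;
--   * a solution needs at least L / 2 vertices, and ⌈ L / 2 ⌉ suffice: pair up
--     the leaves, and if the paths ab and cd are disjoint replace them by
--     ac and bd, which meet and cover both.
-- If H is a single node then m ≤ 1 and a solution of size at most 1 exists.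
-- So the answer is yes if and only if L ≤ 2 k, where L is read off m.
module Submission where

open import Defs
open import Data.Bool.Base using (Bool; true; false; _∧_; _∨_; T)
open import Data.Bool.Properties using (T?; T-∨; T-∧; T-≡)
open import Data.Empty using (⊥; ⊥-elim)
open import Data.Fin.Base using (Fin; zero; suc; toℕ; fromℕ<)
open import Data.Fin.Induction using (spo-noetherian)
open import Data.Fin.Properties using (all?; any?; toℕ<n; toℕ-fromℕ<; toℕ-injective) renaming (_≟_ to _≟ᶠ_)
open import Data.Fin.Subset using (Subset; ∣_∣; Nonempty; ⁅_⁆; ∁; ⊤; _∪_; _-_; _─_; inside; outside) renaming (_∈_ to _∈ˢ_; _∉_ to _∉ˢ_; _⊆_ to _⊆ˢ_; ⊥ to ∅)
open import Data.Fin.Subset.Properties using (x∈p∩q⁺; x∈p∩q⁻; x∈p∪q⁺; x∈p∪q⁻; x∈⁅x⁆; x∈⁅y⁆⇒x≡y; ∉⊥; ∣⊥∣≡0; ∣⁅x⁆∣≡1; x∉p⇒x∈∁p; x∈p∧x≢y⇒x∈p-y; p─q⊆p; x∈p⇒∣p-x∣<∣p∣) renaming (_∈?_ to _∈ˢ?_; ∈⊤ to ∈ˢ⊤)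
open import Data.List.Base using (List; []; _∷_; length; _++_; allFin; map; filter; tabulate) renaming ([_] to [_]ˡ)
open import Data.List.Membership.DecPropositional using () renaming (_∈?_ to mem?)
open import Data.List.Membership.Propositional using (_∈_; _∉_; find; lose)
open import Data.List.Membership.Propositional.Properties using (∈-++⁺ˡ; ∈-++⁺ʳ; ∈-++⁻; ∈-∃++; ∈-allFin; ∈-map⁺; ∈-map⁻; ∈-filter⁺; ∈-filter⁻)
open import Data.List.Properties using (length-++; length-map; length-tabulate)
open import Data.List.Relation.Unary.All as All using (All; []; _∷_)
import Data.List.Relation.Unary.All.Properties as All
open import Data.List.Relation.Unary.AllPairs as AllPairs using (AllPairs; []; _∷_)
import Data.List.Relation.Unary.AllPairs.Properties as AllPairs
open import Data.List.Relation.Unary.Any as Any using (Any; here; there)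
import Data.List.Relation.Unary.Any.Properties as Any
open import Data.List.Relation.Unary.Linked as Linked using (Linked; []; [-]; _∷_)
open import Data.List.Relation.Unary.Unique.Propositional using (Unique)
open import Data.List.Relation.Unary.Unique.Propositional.Properties using (allFin⁺; filter⁺)
open import Data.Nat.Base
open import Data.Nat.Binary.Base using (zero; 2[1+_]; 1+[2_]) renaming (toℕ to toℕᵇ; fromℕ to fromℕᵇ)
open import Data.Nat.Binary.Properties using (toℕ-fromℕ)
open import Data.Nat.Properties
open import Data.Product.Base using (Σ; ∃; ∃-syntax; _×_; _,_; proj₁; proj₂)
open import Data.Sum.Base using (_⊎_; inj₁; inj₂) renaming ([_,_]′ to either; map to map-⊎)
open import Data.Unit.Base using (tt) renaming (⊤ to Unit)
open import Data.Vec.Base using (Vec; []; _∷_; here; there; lookup; _[_]≔_)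
open import Data.Vec.Properties using ([]=⇒lookup; lookup⇒[]=)
open import Data.Vec.Properties.WithK using ([]=-irrelevant)
open import Function.Base using (_∘_; case_of_)
open import Function.Bundles using (_⇔_; mk⇔; Equivalence)
open import Induction.WellFounded using (Acc; acc)
open import Relation.Binary.Construct.Closure.ReflexiveTransitive as Star using (Star; ε; _◅_; _◅◅_)
open import Relation.Binary.Construct.Closure.Transitive using (TransClosure; [_]; _∷_) renaming (_++_ to _++⁺_)
open import Relation.Binary.Definitions using (tri<; tri≈; tri>)
open import Relation.Binary.PropositionalEquality hiding ([_])
open import Relation.Binary.Structures using (IsStrictPartialOrder)
open import Relation.Nullary using (¬_; Dec; yes; no; does; proof; Reflects; ofʸ; ofⁿ; _×-dec_; _⊎-dec_; _→-dec_; ¬?)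
open import Relation.Nullary.Decidable using (dec-true; dec-false; decidable-stable; map′)
open import Relation.Nullary.Reflects using (det)
open Equivalence using (to; from)

-- Polynomial time for a language with loops over the input

-- The input contains no tree model and none is computed: the model occurs only in the correctness
-- proof. The program sees the Boolean matrix whose row `v` records the objects that `v` touches,
-- and all it extracts is the number of distinct inclusion-maximal rows. This keeps it within a
-- small language of loops over the input, whose running time is bounded once and for all. The
-- chosen paths must be joined together not only because a solution has to be connected. An object
-- may meet `H` away from all leaves; it is certain to be touched only when the union of the chosen
-- paths is connected and therefore contains all of `H`. The triangular root is taken with a strict
-- inequality, as the least `s` with `m < 1 + ... + s`. For `m = L (L - 1) / 2` this is exactly `L`.
-- For `m ≤ 1` it is at most 2, so the test `s ≤ 2 k` also gives the right answer when `H` is a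
-- single node, because `k` is positive.

PolyBounded : (ℕ → ℕ) → Set
PolyBounded f = ∃[ c ] ∃[ d ] ∀ N → 1 ≤ N → f N ≤ c * N ^ d

const-poly : ∀ k → PolyBounded (λ _ → k)
const-poly k = k , 0 , λ N _ → ≤-reflexive (sym (*-identityʳ k))

id-poly : PolyBounded (λ N → N)
id-poly = 1 , 1 , λ N _ → ≤-reflexive (sym (trans (*-identityˡ (N ^ 1)) (*-identityʳ N)))

+-poly : ∀ {f g} → PolyBounded f → PolyBounded g → PolyBounded (λ N → f N + g N)
-- Adding the exponents can replace taking their maximum, because `N` is positive.
+-poly {f} {g} (c , d , p) (c′ , d′ , q) = c + c′ , d + d′ , λ N 1≤N →
  let instance _ = >-nonZero 1≤N in begin
    f N + g N                                ≤⟨ +-mono-≤ (p N 1≤N) (q N 1≤N) ⟩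
    c * N ^ d + c′ * N ^ d′                  ≤⟨ +-mono-≤ (*-monoʳ-≤ c (^-monoʳ-≤ N (m≤m+n d d′)))
                                                         (*-monoʳ-≤ c′ (^-monoʳ-≤ N (m≤n+m d′ d))) ⟩
    c * N ^ (d + d′) + c′ * N ^ (d + d′)     ≡⟨ *-distribʳ-+ (N ^ (d + d′)) c c′ ⟨
    (c + c′) * N ^ (d + d′)                  ∎
  where open ≤-Reasoning

*-poly : ∀ {f g} → PolyBounded f → PolyBounded g → PolyBounded (λ N → f N * g N)
*-poly {f} {g} (c , d , p) (c′ , d′ , q) = c * c′ , d + d′ , λ N 1≤N → begin
    f N * g N                     ≤⟨ *-mono-≤ (p N 1≤N) (q N 1≤N) ⟩
    c * N ^ d * (c′ * N ^ d′)     ≡⟨ [m*n]*[o*p]≡[m*o]*[n*p] c (N ^ d) c′ (N ^ d′) ⟩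
    c * c′ * (N ^ d * N ^ d′)     ≡⟨ cong (c * c′ *_) (^-distribˡ-+-* N d d′) ⟨
    c * c′ * N ^ (d + d′)         ∎
  where open ≤-Reasoning

-- Expressions over Fin (suc n): variable 0 is the input, the others are
-- local.  A loop runs over a list computed from the input alone, so the
-- running time is polynomial whatever the values of the local variables;
-- its body sees the current element, the remaining list and the
-- accumulator.
data Tm : ℕ → Set where
  ret  : ∀ {n} → Expr (suc n) → Tm n
  bind : ∀ {n} → Tm n → Tm (suc n) → Tm n
  cond : ∀ {n} → Expr (suc n) → Tm n → Tm n → Tm n
  loop : ∀ {n} → Expr 1 → Expr (suc n) → Tm (3 + n) → Tm n

branch : 𝔻 → 𝔻 → 𝔻 → 𝔻
branch nil     a b = b
branch (_ ∙ _) a b = a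

iterate : (𝔻 → 𝔻 → 𝔻 → 𝔻) → 𝔻 → 𝔻 → 𝔻
iterate step nil     a = a
iterate step (x ∙ r) a = iterate step r (step x r a)

⟦_⟧ : ∀ {n} → Tm n → 𝔻 → Vec 𝔻 n → 𝔻
⟦ ret e ⟧      i ρ = eval e (i ∷ ρ)
⟦ bind t u ⟧   i ρ = ⟦ u ⟧ i (⟦ t ⟧ i ρ ∷ ρ)
⟦ cond e t u ⟧ i ρ = branch (eval e (i ∷ ρ)) (⟦ t ⟧ i ρ) (⟦ u ⟧ i ρ)
⟦ loop f e b ⟧ i ρ =
  iterate (λ x r a → ⟦ b ⟧ i (x ∷ r ∷ a ∷ ρ)) (eval f (i ∷ [])) (eval e (i ∷ ρ))

-- Registers of the compiled program: 0 holds the input, 1 the stack of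
-- local variables, 2 the value of the last term.
pattern stackᵉ  = var (suc zero)
pattern resultᵉ = var (suc (suc zero))
pattern stackʳ  = suc zero
pattern resultʳ = suc (suc zero)

stack : ∀ {n} → Vec 𝔻 n → 𝔻
stack []      = nil
stack (x ∷ ρ) = x ∙ stack ρ

local : ∀ {n} → Fin n → Expr 3 → Expr 3
local zero    s = hd s
local (suc x) s = local x (tl s)

onStack : ∀ {n} → Expr (suc n) → Expr 3
onStack (var zero)    = var zero
onStack (var (suc x)) = local x stackᵉ
onStack nil           = nil
onStack (cons e f)    = cons (onStack e) (onStack f)
onStack (hd e)        = hd (onStack e)
onStack (tl e)        = tl (onStack e)

fromInput : Expr 1 → Expr 3
fromInput (var x)    = var zero
fromInput nil        = nil
fromInput (cons e f) = cons (fromInput e) (fromInput f)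
fromInput (hd e)     = hd (fromInput e)
fromInput (tl e)     = tl (fromInput e)

-- During a loop the top of the stack is the remaining list, and the accumulator lies under it.
-- `enter` splits the list so that the body finds its three local variables; `next` discards the
-- element and overwrites the accumulator.
loopTest : Expr 3
loopTest = hd stackᵉ

enter next : Expr 3
enter = cons (hd (hd stackᵉ)) (cons (tl (hd stackᵉ)) (tl stackᵉ))
next  = cons (hd (tl stackᵉ)) (cons resultᵉ (tl (tl (tl stackᵉ))))

compile : ∀ {n} → Tm n → Cmd 3
compile (ret e)      = resultʳ ≔ onStack e
compile (bind t u)   =
  compile t ⨾ stackʳ ≔ cons resultᵉ stackᵉ ⨾ compile u ⨾ stackʳ ≔ tl stackᵉ
compile (cond e t u) = if onStack e then compile t else compile u
compile (loop f e b) =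
  stackʳ ≔ cons (fromInput f) (cons (onStack e) stackᵉ) ⨾
  (while loopTest loop (stackʳ ≔ enter ⨾ compile b ⨾ stackʳ ≔ next)) ⨾
  resultʳ ≔ hd (tl stackᵉ) ⨾
  stackʳ ≔ tl (tl stackᵉ)

local-correct : ∀ {n} (x : Fin n) (ρ : Vec 𝔻 n) (s : Expr 3) σ →
  eval s σ ≡ stack ρ → eval (local x s) σ ≡ lookup ρ x
local-correct zero    (y ∷ ρ) s σ eq = cong head eq
local-correct (suc x) (y ∷ ρ) s σ eq = local-correct x ρ (tl s) σ (cong tail eq)

onStack-correct : ∀ {n} (e : Expr (suc n)) i (ρ : Vec 𝔻 n) r →
  eval (onStack e) (i ∷ stack ρ ∷ r ∷ []) ≡ eval e (i ∷ ρ)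
onStack-correct (var zero)    i ρ r = refl
onStack-correct (var (suc x)) i ρ r = local-correct x ρ stackᵉ _ refl
onStack-correct nil           i ρ r = refl
onStack-correct (cons e f)    i ρ r = cong₂ _∙_ (onStack-correct e i ρ r) (onStack-correct f i ρ r)
onStack-correct (hd e)        i ρ r = cong head (onStack-correct e i ρ r)
onStack-correct (tl e)        i ρ r = cong tail (onStack-correct e i ρ r)

fromInput-correct : ∀ (e : Expr 1) i s r → eval (fromInput e) (i ∷ s ∷ r ∷ []) ≡ eval e (i ∷ [])
fromInput-correct (var zero) i s r = refl
fromInput-correct nil        i s r = refl
fromInput-correct (cons e f) i s r = cong₂ _∙_ (fromInput-correct e i s r) (fromInput-correct f i s r)
fromInput-correct (hd e)     i s r = cong head (fromInput-correct e i s r)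
fromInput-correct (tl e)     i s r = cong tail (fromInput-correct e i s r)

-- Running time of compiled terms

1≤size : ∀ a → 1 ≤ size a
1≤size nil     = s≤s z≤n
1≤size (a ∙ b) = s≤s z≤n

size-head : ∀ a → size (head a) ≤ size a
size-head nil     = ≤-refl
size-head (a ∙ b) = m≤n⇒m≤1+n (m≤m+n (size a) (size b))

size-tail : ∀ a → size (tail a) ≤ size a
size-tail nil     = ≤-refl
size-tail (a ∙ b) = m≤n⇒m≤1+n (m≤n+m (size b) (size a))

-- Each node of `e` adds at most one copy of the input. This bounds the number of rounds of a loop,
-- whose list is such an expression.
size-eval : ∀ (e : Expr 1) i → size (eval e (i ∷ [])) ≤ cost e * size i
size-eval (var zero) i = m≤m+n (size i) 0
size-eval nil        i = ≤-trans (1≤size i) (m≤m+n (size i) 0)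
size-eval (cons e f) i = +-mono-≤ (1≤size i)
  (≤-trans (+-mono-≤ (size-eval e i) (size-eval f i))
           (≤-reflexive (sym (*-distribʳ-+ (size i) (cost e) (cost f)))))
size-eval (hd e)     i = ≤-trans (size-head (eval e _)) (≤-trans (size-eval e i) (m≤n+m _ (size i)))
size-eval (tl e)     i = ≤-trans (size-tail (eval e _)) (≤-trans (size-eval e i) (m≤n+m _ (size i)))

length𝔻 : 𝔻 → ℕ
length𝔻 nil     = 0
length𝔻 (_ ∙ b) = suc (length𝔻 b)

length𝔻≤size : ∀ a → length𝔻 a ≤ size a
length𝔻≤size nil     = z≤n
length𝔻≤size (a ∙ b) = s≤s (≤-trans (length𝔻≤size b) (m≤n+m (size b) (size a)))

roundTime : ℕ → ℕ
roundTime t = suc (cost loopTest + suc (suc (cost enter) + suc (t + suc (cost next))))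

initTime : ∀ {n} → Expr 1 → Expr (suc n) → ℕ
initTime f e = suc (cost (cons (fromInput f) (cons (onStack e) stackᵉ)))

timeBound : ∀ {n} → Tm n → ℕ → ℕ
timeBound (ret e)      N = suc (cost (onStack e))
timeBound (bind t u)   N = suc (timeBound t N + suc (4 + suc (timeBound u N + 3)))
-- The sum of both branches instead of their maximum, so that `+-poly` applies.
timeBound (cond e t u) N = suc (cost (onStack e) + (timeBound t N + timeBound u N))
timeBound (loop f e b) N =
  -- `3` pays for the last, failing test, and `4 + 4` for fetching the accumulator and popping the
  -- stack.
  suc (initTime f e + suc (cost f * N * roundTime (timeBound b N) + 3 + suc (4 + 4)))

timeBound-poly : ∀ {n} (t : Tm n) → PolyBounded (timeBound t)
timeBound-poly (ret e)      = const-poly (suc (cost (onStack e)))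
timeBound-poly (bind t u)   =
  +-poly (const-poly 1) (+-poly (timeBound-poly t)
    (+-poly (const-poly 6) (+-poly (timeBound-poly u) (const-poly 3))))
timeBound-poly (cond e t u) =
  +-poly (const-poly 1) (+-poly (const-poly (cost (onStack e))) (+-poly (timeBound-poly t) (timeBound-poly u)))
timeBound-poly (loop f e b) =
  +-poly (const-poly 1) (+-poly (const-poly (initTime f e)) (+-poly (const-poly 1)
    (+-poly (+-poly (*-poly (*-poly (const-poly (cost f)) id-poly) round) (const-poly 3)) (const-poly 9))))
  where
  round : PolyBounded (λ N → roundTime (timeBound b N))
  round = +-poly (const-poly (suc (cost loopTest + suc (suc (cost enter) + 1))))
            (+-poly (timeBound-poly b) (const-poly (suc (cost next))))

Run : ∀ {n} → Cmd n → Store n → Store n → ℕ → Set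
Run c σ σ′ T = ∃[ t ] (⟨ c , σ ⟩⇓ σ′ [ t ] × t ≤ T)

≔-run : ∀ {n x a} {e : Expr n} {σ} → eval e σ ≡ a → Run (x ≔ e) σ (σ [ x ]≔ a) (suc (cost e))
≔-run refl = _ , assign , ≤-refl

⨾-run : ∀ {n} {c d : Cmd n} {σ σ′ σ″ T T′} → Run c σ σ′ T → Run d σ′ σ″ T′ → Run (c ⨾ d) σ σ″ (suc (T + T′))
⨾-run (_ , p , t≤) (_ , q , t′≤) = _ , seq p q , s≤s (+-mono-≤ t≤ t′≤)

compile-correct : ∀ {n} (t : Tm n) i (ρ : Vec 𝔻 n) r →
  Run (compile t) (i ∷ stack ρ ∷ r ∷ []) (i ∷ stack ρ ∷ ⟦ t ⟧ i ρ ∷ []) (timeBound t (size i))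
compile-correct (ret e) i ρ r = ≔-run (onStack-correct e i ρ r)
compile-correct (bind t u) i ρ r =
  ⨾-run (compile-correct t i ρ r) (⨾-run (≔-run refl) (⨾-run (compile-correct u i (_ ∷ ρ) _) (≔-run refl)))
compile-correct (cond e t u) i ρ r with eval e (i ∷ ρ) in eq
... | a ∙ b = let _ , p , t≤ = compile-correct t i ρ r in
  _ , if-true (trans (onStack-correct e i ρ r) eq) p ,
  s≤s (+-monoʳ-≤ (cost (onStack e)) (≤-trans t≤ (m≤m+n _ _)))
... | nil = let _ , p , t≤ = compile-correct u i ρ r in
  _ , if-false (trans (onStack-correct e i ρ r) eq) p ,
  s≤s (+-monoʳ-≤ (cost (onStack e)) (≤-trans t≤ (m≤n+m _ _)))
compile-correct (loop f e b) i ρ r =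
  ⨾-run (≔-run (cong₂ _∙_ (fromInput-correct f i (stack ρ) r) (cong (_∙ stack ρ) (onStack-correct e i ρ r))))
    (⨾-run (rounds l (eval e (i ∷ ρ)) r .proj₂ .proj₁ , rounds l (eval e (i ∷ ρ)) r .proj₂ .proj₂ .proj₁ ,
            ≤-trans (rounds l (eval e (i ∷ ρ)) r .proj₂ .proj₂ .proj₂)
              (+-monoˡ-≤ 3 (*-monoˡ-≤ R (≤-trans (length𝔻≤size l) (size-eval f i)))))
      (⨾-run (≔-run refl) (≔-run refl)))
  where
  l = eval f (i ∷ [])
  R = roundTime (timeBound b (size i))
  step : 𝔻 → 𝔻 → 𝔻 → 𝔻
  step x r a = ⟦ b ⟧ i (x ∷ r ∷ a ∷ ρ)
  -- The final result register is existential because a loop over the empty list leaves it as it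
  -- was.
  rounds : ∀ l a r → ∃[ r′ ]
    Run (while loopTest loop (stackʳ ≔ enter ⨾ compile b ⨾ stackʳ ≔ next))
        (i ∷ (l ∙ a ∙ stack ρ) ∷ r ∷ []) (i ∷ (nil ∙ iterate step l a ∙ stack ρ) ∷ r′ ∷ []) (length𝔻 l * R + 3)
  rounds nil     a r = r , _ , while-stop refl , ≤-refl
  rounds (x ∙ l) a r
    with _ , p , t≤ ← ⨾-run (≔-run {x = stackʳ} {e = enter} {σ = i ∷ ((x ∙ l) ∙ a ∙ stack ρ) ∷ r ∷ []} refl)
                       (⨾-run (compile-correct b i (x ∷ l ∷ a ∷ ρ) r) (≔-run {x = stackʳ} {e = next} refl))
       | r′ , _ , q , t′≤ ← rounds l (step x l a) (step x l a)
    = r′ , _ , while-step refl p q ,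
      ≤-trans (+-mono-≤ (s≤s (+-monoʳ-≤ (cost loopTest) t≤)) t′≤)
              (≤-reflexive (sym (+-assoc R (length𝔻 l * R) 3)))

polynomialTime : ∀ {P} (t : Tm 0) →
  (∀ I → ∃[ answer ] (Reflects (DecisionProblem.Yes P I) answer ×
    ⟦ t ⟧ (DecisionProblem.encode P I) [] ≡ encodeBool answer)) →
  PolynomialTime P
polynomialTime {P} t decides
  with c , d , bounded ← +-poly (const-poly 1) (+-poly (timeBound-poly t) (const-poly 2))
  = program (compile t ⨾ zero ≔ resultᵉ) , c , d , λ I →
    let answer , reflects , eq = decides I
        i = DecisionProblem.encode P I
        _ , run , t≤ = ⨾-run (compile-correct t i [] nil) (≔-run {x = zero} {e = resultᵉ} refl)
    in answer , reflects , _ , _ , run , eq , ≤-trans t≤ (bounded (size i) (1≤size i))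

-- The algorithm

pattern v1 = var (suc zero)
pattern v2 = var (suc (suc zero))
pattern v3 = var (suc (suc (suc zero)))
pattern v4 = var (suc (suc (suc (suc zero))))
pattern v5 = var (suc (suc (suc (suc (suc zero)))))
pattern v6 = var (suc (suc (suc (suc (suc (suc zero))))))
pattern v7 = var (suc (suc (suc (suc (suc (suc (suc zero)))))))
pattern v8 = var (suc (suc (suc (suc (suc (suc (suc (suc zero))))))))
pattern v9 = var (suc (suc (suc (suc (suc (suc (suc (suc (suc zero)))))))))
pattern v10 = var (suc (suc (suc (suc (suc (suc (suc (suc (suc (suc zero))))))))))
pattern v11 = var (suc (suc (suc (suc (suc (suc (suc (suc (suc (suc (suc zero)))))))))))

wk : ∀ {n} → Expr (suc n) → Expr (suc (suc n))
wk (var zero)    = var zero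
wk (var (suc x)) = var (suc (suc x))
wk nil           = nil
wk (cons e f)    = cons (wk e) (wk f)
wk (hd e)        = hd (wk e)
wk (tl e)        = tl (wk e)

eval-wk : ∀ {n} (e : Expr (suc n)) i x (ρ : Vec 𝔻 n) → eval (wk e) (i ∷ x ∷ ρ) ≡ eval e (i ∷ ρ)
eval-wk (var zero)    i x ρ = refl
eval-wk (var (suc y)) i x ρ = refl
eval-wk nil           i x ρ = refl
eval-wk (cons e f)    i x ρ = cong₂ _∙_ (eval-wk e i x ρ) (eval-wk f i x ρ)
eval-wk (hd e)        i x ρ = cong head (eval-wk e i x ρ)
eval-wk (tl e)        i x ρ = cong tail (eval-wk e i x ρ)

-- Numbers and indices are represented by the lengths of lists.  In a loop
-- over the rows of the adjacency matrix the remaining list is thus the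
-- index of the current element counted from the end, so that consing
-- results builds a list in the right order.
rows rows⁺ : Expr 1
rows  = hd (var zero)
rows⁺ = cons nil rows

ttᵉ : ∀ {n} → Expr n
ttᵉ = cons nil nil

notT : ∀ {n} → Tm (suc n)
notT = cond v1 (ret nil) (ret ttᵉ)

-- The accumulator pairs the rest of the index with the rest of the list. The `n + 1` rounds over
-- `rows⁺` suffice, since every number dropped by the algorithm is at most `n + 1`.
dropT : ∀ {n} → Expr (suc n) → Expr (suc n) → Tm n
dropT i l = bind
  (loop rows⁺ (cons i l) (cond (hd v3) (ret (cons (tl (hd v3)) (tl (tl v3)))) (ret v3)))
  (ret (tl v1))

leT eqT : ∀ {n} → Expr (suc n) → Expr (suc n) → Tm n
leT i j = bind (dropT j i) notT
eqT i j = bind (leT i j) (cond v1 (leT (wk j) (wk i)) (ret nil))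

entryT : ∀ {n} → Expr (suc n) → Expr (suc n) → Expr (suc n) → Tm n
entryT M i j = bind (dropT i M) (bind (dropT (wk j) (hd v1)) (ret (hd v1)))

tableT : ∀ {n} → Tm (3 + n) → Tm n
tableT b = loop rows nil (bind b (ret (cons v1 v4)))

allT : ∀ {n} → Tm (3 + n) → Tm n
allT b = loop rows ttᵉ (cond v3 b (ret nil))

-- The matrices below have row index v5 and column index v2.
closedNeighbourT : Tm 6
closedNeighbourT = bind (eqT v5 v2) (cond v1 (ret ttᵉ) (entryT (hd (var zero)) v6 v3))

closedNeighbourhoodsT : Tm 0
closedNeighbourhoodsT = tableT (tableT closedNeighbourT)

-- Only the columns are masked. After the transitive closure the row of any vertex, terminal or not,
-- thus lists the terminals of the components of G[X] that it meets.
maskedEntryT : Tm 7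
maskedEntryT = bind (dropT v2 (hd (tl (var zero)))) (cond (hd v1) (entryT v8 v6 v3) (ret nil))

maskT : Tm 1
maskT = tableT (tableT maskedEntryT)

-- Warshall's algorithm; the pivot is v8 and the matrix is v9.
pivotT : ∀ {n} → Tm (9 + n)
pivotT = bind (entryT v9 v5 v2) (cond v1 (ret ttᵉ)
  (bind (entryT v10 v6 v9) (cond v1 (entryT v11 v10 v4) (ret nil))))

closureT : ∀ {n} → Tm (suc n)
closureT = loop rows v1 (tableT (tableT pivotT))

implicationT : ∀ {n} → Tm (10 + n)
implicationT = bind (entryT v10 v8 v2) (cond v1 (entryT v11 v6 v3) (ret ttᵉ))

inclusionsT : ∀ {n} → Tm (suc n)
inclusionsT = tableT (tableT (allT implicationT))

precedesT : ∀ {n} → Tm (7 + n)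
precedesT = bind (entryT v7 v5 v2) (cond v1
  (bind (entryT v8 v3 v6) (cond v1 (leT v7 v4) (ret nil)))
  (ret ttᵉ))

-- One more than the number of rows that are counted.
countT : ∀ {n} → Tm (suc n)
countT = loop rows ttᵉ (bind (allT precedesT) (cond v1 (ret (cons nil v4)) (ret v4)))

-- Subtracts 1, 2, 3, ... from the count, which is `m + 1`, until nothing remains; the number of
-- subtractions is the root.
triangularRootT : ∀ {n} → Tm (suc n)
triangularRootT = bind
  (loop rows⁺ (cons nil v1) (cond (tl v3)
    (bind (dropT (cons nil (hd v3)) (tl v3)) (ret (cons (cons nil (hd v4)) v1)))
    (ret v3)))
  (ret (hd v1))

-- Removes two elements per round. Since `tl` of `nil` is `nil`, a single remaining element still
-- counts as a round, so the result is rounded up.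
halfT : ∀ {n} → Expr (suc n) → Tm n
halfT u = bind
  (loop rows⁺ (cons nil u) (cond (tl v3) (ret (cons (cons nil (hd v3)) (tl (tl (tl v3))))) (ret v3)))
  (ret (hd v1))

-- u ≤ 2 k + d if and only if ⌈ (u ∸ d) / 2 ⌉ ≤ k, so the binary number k
-- is compared with the unary number u digit by digit.
atMostT : ∀ {n} → Expr 1 → Tm (suc n)
atMostT k = bind (loop k v1 (cond v1 (halfT (tl (tl v3))) (halfT (tl v3)))) notT

decideT : Tm 0 → Expr 1 → Tm 0
decideT M k =
  bind M (bind inclusionsT (bind countT (bind triangularRootT (bind (halfT v1) (atMostT k)))))

-- Vectors, matrices and unary numbers as trees

drops : 𝔻 → 𝔻 → 𝔻
drops nil     l = l
drops (_ ∙ i) l = drops i (tail l)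

tail-drops : ∀ i l → tail (drops i l) ≡ drops i (tail l)
tail-drops nil     l = refl
tail-drops (_ ∙ i) l = tail-drops i (tail l)

length-tail : ∀ l → length𝔻 (tail l) ≡ pred (length𝔻 l)
length-tail nil     = refl
length-tail (_ ∙ _) = refl

length-drops : ∀ i l → length𝔻 (drops i l) ≡ length𝔻 l ∸ length𝔻 i
length-drops nil     l = refl
length-drops (_ ∙ i) l = trans (length-drops i (tail l))
  (trans (cong (_∸ length𝔻 i) (length-tail l)) (pred[m]∸n≡m∸[1+n]′ (length𝔻 l) (length𝔻 i)))
  where
  pred[m]∸n≡m∸[1+n]′ : ∀ m n → pred m ∸ n ≡ m ∸ suc n
  pred[m]∸n≡m∸[1+n]′ zero    n = 0∸n≡0 n
  pred[m]∸n≡m∸[1+n]′ (suc m) n = refl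

module _ {n : ℕ} where

  -- Specified by the results of indexing and not by equality with an encoding, so that the input
  -- and the computed tables fall under the same notion.
  IsVector : 𝔻 → (Fin n → 𝔻) → Set
  IsVector l g = ∀ j r → length𝔻 r ≡ toℕ j → head (drops r l) ≡ g j

  IsMatrix : 𝔻 → (Fin n → Fin n → Bool) → Set
  IsMatrix M f = ∀ i r → length𝔻 r ≡ toℕ i → IsVector (head (drops r M)) (encodeBool ∘ f i)

encodeList-isVector : ∀ {A : Set} {n} (enc : A → 𝔻) (f : Fin n → A) →
                      IsVector (encodeList enc (tabulate f)) (enc ∘ f)
encodeList-isVector enc f zero    nil     eq = refl
encodeList-isVector enc f (suc j) (_ ∙ r) eq = encodeList-isVector enc (f ∘ suc) j r (suc-injective eq)

length-encodeList : ∀ {A : Set} {n} (enc : A → 𝔻) (f : Fin n → A) →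
                    length𝔻 (encodeList enc (tabulate f)) ≡ n
length-encodeList {n = zero}  enc f = refl
length-encodeList {n = suc n} enc f = cong suc (length-encodeList enc (f ∘ suc))

not-leq : ∀ i l → branch (drops i l) nil (nil ∙ nil) ≡ encodeBool (does (length𝔻 l ≤? length𝔻 i))
not-leq i l with drops i l | length-drops i l
... | nil   | eq = cong encodeBool (sym (dec-true (length𝔻 l ≤? length𝔻 i) (m∸n≡0⇒m≤n (sym eq))))
... | _ ∙ _ | eq = cong encodeBool (sym (dec-false (length𝔻 l ≤? length𝔻 i)
                     λ p → case trans eq (m≤n⇒m∸n≡0 p) of λ ()))

does-cong : ∀ {A B : Set} (a? : Dec A) (b? : Dec B) → (A → B) → (B → A) → does a? ≡ does b?
does-cong (yes _) (yes _) f g = refl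
does-cong (yes a) (no ¬b) f g = ⊥-elim (¬b (f a))
does-cong (no ¬a) (yes b) f g = ⊥-elim (¬a (g b))
does-cong (no _)  (no _)  f g = refl

iterate-drops : ∀ (v : 𝔻 → 𝔻 → 𝔻 → 𝔻) l a d → length𝔻 d ≡ length𝔻 l →
                drops d (iterate (λ x r a → v x r a ∙ a) l a) ≡ a
iterate-drops v nil     a nil     eq = refl
iterate-drops v (x ∙ l) a (_ ∙ d) eq =
  trans (sym (tail-drops d _)) (cong tail (iterate-drops v l (v x l a ∙ a) d (suc-injective eq)))

-- After the round in which as many elements remain as `d` has, exactly that many entries are consed
-- in front; dropping them leads back to the entry of that round.
iterate-entry : ∀ (v : 𝔻 → 𝔻 → 𝔻 → 𝔻) l a d → length𝔻 d < length𝔻 l →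
  ∃[ x ] ∃[ r ] ∃[ b ] (length𝔻 r ≡ length𝔻 d × head (drops d (iterate (λ x r a → v x r a ∙ a) l a)) ≡ v x r b)
iterate-entry v (x ∙ l) a d (s≤s d≤l) with m≤n⇒m<n∨m≡n d≤l
... | inj₁ d<l = iterate-entry v l (v x l a ∙ a) d d<l
... | inj₂ d≡l = x , l , a , sym d≡l , cong head (iterate-drops v l (v x l a ∙ a) d d≡l)

triangle : ℕ → ℕ
triangle zero    = 0
triangle (suc s) = suc s + triangle s

n≤triangle : ∀ n → n ≤ triangle n
n≤triangle zero    = z≤n
n≤triangle (suc n) = m≤m+n (suc n) (triangle n)

module _ {n : ℕ} (f : Fin n → Fin n → Bool) where

  Included : Fin n → Fin n → Set
  Included r s = ∀ j → T (f r j) → T (f s j)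

  opaque
    included? : ∀ r s → Dec (Included r s)
    included? r s = all? λ j → T? (f r j) →-dec T? (f s j)

  -- The first of the rows with a given inclusion-maximal value.
  Counted : Fin n → Set
  Counted r = ∀ s → Included r s → Included s r × toℕ r ≤ toℕ s

  opaque
    counted? : ∀ r → Dec (Counted r)
    counted? r = all? λ s → included? r s →-dec (included? s r ×-dec (toℕ r ≤? toℕ s))

-- Correctness of the algorithm's parts

module Semantics (i : 𝔻) (n : ℕ) (length-rows : length𝔻 (head i) ≡ n) where

  drop-correct : ∀ {m} (e l : Expr (suc m)) ρ → length𝔻 (eval e (i ∷ ρ)) ≤ suc n →
                 ⟦ dropT e l ⟧ i ρ ≡ drops (eval e (i ∷ ρ)) (eval l (i ∷ ρ))
  drop-correct e l ρ ≤n = cong tail (go (nil ∙ head i) (eval e _) (eval l _)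
      (subst (λ k → length𝔻 (eval e (i ∷ ρ)) ≤ suc k) (sym length-rows) ≤n))
    where
    go : ∀ fuel d l → length𝔻 d ≤ length𝔻 fuel →
         iterate (λ x r a → branch (head a) (tail (head a) ∙ tail (tail a)) a) fuel (d ∙ l) ≡ nil ∙ drops d l
    go nil        nil     l p       = refl
    go (_ ∙ fuel) nil     l p       = go fuel nil l z≤n
    go (_ ∙ fuel) (_ ∙ d) l (s≤s p) = go fuel d (tail l) p

  le-correct : ∀ {m} (a b : Expr (suc m)) ρ → length𝔻 (eval b (i ∷ ρ)) ≤ suc n →
    ⟦ leT a b ⟧ i ρ ≡ encodeBool (does (length𝔻 (eval a (i ∷ ρ)) ≤? length𝔻 (eval b (i ∷ ρ))))
  le-correct a b ρ ≤n = trans (cong (λ d → branch d nil (nil ∙ nil)) (drop-correct b a ρ ≤n)) (not-leq (eval b _) (eval a _))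

  index≤ : ∀ {r} (j : Fin n) → length𝔻 r ≡ toℕ j → length𝔻 r ≤ suc n
  index≤ j eq = subst (_≤ suc n) (sym eq) (m≤n⇒m≤1+n (<⇒≤ (toℕ<n j)))

  eq-correct : ∀ {m} (a b : Expr (suc m)) ρ (j k : Fin n) →
    length𝔻 (eval a (i ∷ ρ)) ≡ toℕ j → length𝔻 (eval b (i ∷ ρ)) ≡ toℕ k →
    ⟦ eqT a b ⟧ i ρ ≡ encodeBool (does (j ≟ᶠ k))
  eq-correct a b ρ j k eqa eqb
    rewrite le-correct a b ρ (index≤ k eqb)
          | le-correct (wk b) (wk a) (encodeBool (does (length𝔻 (eval a (i ∷ ρ)) ≤? length𝔻 (eval b (i ∷ ρ)))) ∷ ρ)
              (subst (λ d → length𝔻 d ≤ suc n) (sym (eval-wk a i _ ρ)) (index≤ j eqa))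
          | eval-wk a i (encodeBool (does (length𝔻 (eval a (i ∷ ρ)) ≤? length𝔻 (eval b (i ∷ ρ))))) ρ
          | eval-wk b i (encodeBool (does (length𝔻 (eval a (i ∷ ρ)) ≤? length𝔻 (eval b (i ∷ ρ))))) ρ
          | eqa | eqb
    with toℕ j ≤? toℕ k
  ... | yes p rewrite dec-true (toℕ j ≤? toℕ k) p =
        cong encodeBool (does-cong (toℕ k ≤? toℕ j) (j ≟ᶠ k) (λ q → toℕ-injective (≤-antisym p q)) λ { refl → ≤-refl })
  ... | no ¬p rewrite dec-false (toℕ j ≤? toℕ k) ¬p =
        cong encodeBool (sym (dec-false (j ≟ᶠ k) λ { refl → ¬p ≤-refl }))

  entry-correct : ∀ {m} (M a b : Expr (suc m)) ρ {f : Fin n → Fin n → Bool} (j k : Fin n) →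
    IsMatrix (eval M (i ∷ ρ)) f →
    length𝔻 (eval a (i ∷ ρ)) ≡ toℕ j → length𝔻 (eval b (i ∷ ρ)) ≡ toℕ k →
    ⟦ entryT M a b ⟧ i ρ ≡ encodeBool (f j k)
  entry-correct M a b ρ j k isM eqa eqb
    rewrite drop-correct (wk b) (hd v1) (⟦ dropT a M ⟧ i ρ ∷ ρ)
              (subst (λ d → length𝔻 d ≤ suc n) (sym (eval-wk b i _ ρ)) (index≤ k eqb))
          | drop-correct a M ρ (index≤ j eqa)
          | eval-wk b i (drops (eval a (i ∷ ρ)) (eval M (i ∷ ρ))) ρ
    = isM j _ eqa k _ eqb

  -- The predicate `P` is arbitrary in order to cover both levels of a matrix: an inner entry equals
  -- an encoded bit, whereas an outer entry is a row known only through `IsVector`.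
  table-entry : ∀ {m} (b : Tm (3 + m)) ρ (P : 𝔻 → Set) (j : Fin n) →
    (∀ x r a → length𝔻 r ≡ toℕ j → P (⟦ b ⟧ i (x ∷ r ∷ a ∷ ρ))) →
    ∀ r → length𝔻 r ≡ toℕ j → P (head (drops r (⟦ tableT b ⟧ i ρ)))
  table-entry b ρ P j p r eq
    with x , s , a , eq′ , eq″ ← iterate-entry (λ x r a → ⟦ b ⟧ i (x ∷ r ∷ a ∷ ρ)) (head i) nil r
           (subst₂ _<_ (sym eq) (sym length-rows) (toℕ<n j))
    = subst P (sym eq″) (p x s a (trans eq′ eq))

  ComputesEntries : ∀ {m} → Tm (6 + m) → Vec 𝔻 m → (Fin n → Fin n → Bool) → Set
  ComputesEntries b ρ f =
    ∀ j k x r a x′ r′ a′ → length𝔻 r ≡ toℕ j → length𝔻 r′ ≡ toℕ k →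
    ⟦ b ⟧ i (x′ ∷ r′ ∷ a′ ∷ x ∷ r ∷ a ∷ ρ) ≡ encodeBool (f j k)

  matrix-correct : ∀ {m} (b : Tm (6 + m)) ρ (f : Fin n → Fin n → Bool) →
    ComputesEntries b ρ f → IsMatrix (⟦ tableT (tableT b) ⟧ i ρ) f
  matrix-correct b ρ f p j = table-entry (tableT b) ρ (λ l → IsVector l (encodeBool ∘ f j)) j
    λ x r a eq k → table-entry b (x ∷ r ∷ a ∷ ρ) (_≡ encodeBool (f j k)) k
      λ x′ r′ a′ → p j k x r a x′ r′ a′ eq

  all-correct : ∀ {m} (b : Tm (3 + m)) ρ {Q : Fin n → Set} (Q? : ∀ j → Dec (Q j)) →
    (∀ j x r a → length𝔻 r ≡ toℕ j → ⟦ b ⟧ i (x ∷ r ∷ a ∷ ρ) ≡ encodeBool (does (Q? j))) →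
    ⟦ allT b ⟧ i ρ ≡ encodeBool (does (all? Q?))
  all-correct b ρ {Q} Q? p =
    let c , eq , q = go (head i) true (≤-reflexive length-rows)
                       (ofʸ λ j n≤j → ⊥-elim (<⇒≱ (toℕ<n j) (subst (_≤ toℕ j) length-rows n≤j)))
    in trans eq (cong encodeBool (det q (proof (all? Q?))))
    where
    -- Indices are tested from the largest downwards, so `c` tells whether `Q` holds from
    -- `length𝔻 l` on.
    go : ∀ l c → length𝔻 l ≤ n → Reflects (∀ j → length𝔻 l ≤ toℕ j → Q j) c →
      ∃[ c′ ] (iterate (λ x r a → branch a (⟦ b ⟧ i (x ∷ r ∷ a ∷ ρ)) nil) l (encodeBool c) ≡ encodeBool c′
              × Reflects (∀ j → Q j) c′)
    go nil     true  ≤n (ofʸ q) = true , refl , ofʸ λ j → q j z≤n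
    go nil     false ≤n (ofⁿ ¬q) = false , refl , ofⁿ λ q → ¬q λ j _ → q j
    go (x ∙ l) false ≤n (ofⁿ ¬q) = go l false (<⇒≤ ≤n) (ofⁿ λ q → ¬q λ j l<j → q j (<⇒≤ l<j))
    go (x ∙ l) true  ≤n (ofʸ q)
      rewrite p (fromℕ< ≤n) x l (nil ∙ nil) (sym (toℕ-fromℕ< ≤n)) with Q? (fromℕ< ≤n)
    ... | yes y = go l true (<⇒≤ ≤n) (ofʸ λ j l≤j → case m≤n⇒m<n∨m≡n l≤j of λ where
            (inj₁ l<j) → q j l<j
            (inj₂ l≡j) → subst Q (toℕ-injective (trans (toℕ-fromℕ< ≤n) l≡j)) y)
    ... | no ¬y = go l false (<⇒≤ ≤n) (ofⁿ λ q → ¬y (q (fromℕ< ≤n) (≤-reflexive (sym (toℕ-fromℕ< ≤n)))))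

  closedNeighbourhoods-correct : ∀ {f} → IsMatrix (head i) f →
    IsMatrix (⟦ closedNeighbourhoodsT ⟧ i []) (λ j k → does (j ≟ᶠ k) ∨ f j k)
  closedNeighbourhoods-correct {f} isM =
    matrix-correct closedNeighbourT [] (λ j k → does (j ≟ᶠ k) ∨ f j k) entry
    where
    entry : ComputesEntries closedNeighbourT [] (λ j k → does (j ≟ᶠ k) ∨ f j k)
    entry j k x r a x′ r′ a′ eq eq′ rewrite eq-correct v5 v2 (x′ ∷ r′ ∷ a′ ∷ x ∷ r ∷ a ∷ []) j k eq eq′
      with does (j ≟ᶠ k)
    ... | true  = refl
    ... | false = entry-correct (hd (var zero)) v6 v3 (nil ∷ x′ ∷ r′ ∷ a′ ∷ x ∷ r ∷ a ∷ []) j k isM eq eq′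

  mask-correct : ∀ {f} M {X} → IsMatrix M f → IsVector (head (tail i)) (encodeBool ∘ X) →
    IsMatrix (⟦ maskT ⟧ i (M ∷ [])) (λ j k → X k ∧ f j k)
  mask-correct {f} M {X} isM isX = matrix-correct maskedEntryT (M ∷ []) (λ j k → X k ∧ f j k) entry
    where
    entry : ComputesEntries maskedEntryT (M ∷ []) (λ j k → X k ∧ f j k)
    entry j k x r a x′ r′ a′ eq eq′
      rewrite drop-correct v2 (hd (tl (var zero))) (x′ ∷ r′ ∷ a′ ∷ x ∷ r ∷ a ∷ M ∷ []) (index≤ k eq′)
            | isX k r′ eq′
      with X k
    ... | true  = entry-correct v8 v6 v3 (drops r′ (head (tail i)) ∷ x′ ∷ r′ ∷ a′ ∷ x ∷ r ∷ a ∷ M ∷ []) j k isM eq eq′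
    ... | false = refl

  warshallStep : Fin n → (Fin n → Fin n → Bool) → Fin n → Fin n → Bool
  warshallStep p f j k = f j k ∨ (f j p ∧ f p k)

  warshallStep-correct : ∀ {m} (ρ : Vec 𝔻 m) x₀ r₀ M {f} p → length𝔻 r₀ ≡ toℕ p → IsMatrix M f →
    IsMatrix (⟦ tableT (tableT pivotT) ⟧ i (x₀ ∷ r₀ ∷ M ∷ ρ))
      (warshallStep p f)
  warshallStep-correct ρ x₀ r₀ M {f} p eq₀ isM = matrix-correct pivotT (x₀ ∷ r₀ ∷ M ∷ ρ) (warshallStep p f) entry
    where
    entry : ComputesEntries pivotT (x₀ ∷ r₀ ∷ M ∷ ρ) (warshallStep p f)
    entry j k x r a x′ r′ a′ eq eq′
      rewrite entry-correct v9 v5 v2 (x′ ∷ r′ ∷ a′ ∷ x ∷ r ∷ a ∷ x₀ ∷ r₀ ∷ M ∷ ρ) j k isM eq eq′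
      with f j k
    ... | true = refl
    ... | false
      rewrite entry-correct v10 v6 v9 (nil ∷ x′ ∷ r′ ∷ a′ ∷ x ∷ r ∷ a ∷ x₀ ∷ r₀ ∷ M ∷ ρ) j p isM eq eq₀
      with f j p
    ... | true  = entry-correct v11 v10 v4 ((nil ∙ nil) ∷ nil ∷ x′ ∷ r′ ∷ a′ ∷ x ∷ r ∷ a ∷ x₀ ∷ r₀ ∷ M ∷ ρ) p k isM eq₀ eq′
    ... | false = refl

  -- Invariant: the matrix is transitive through the pivots processed so far.
  closure-correct : ∀ {m} (ρ : Vec 𝔻 m) M f → IsMatrix M f →
    ∃[ g ] (IsMatrix (⟦ closureT ⟧ i (M ∷ ρ)) g ×
            ∀ j k → T (g j k) ⇔ TransClosure (λ j k → T (f j k)) j k)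
  closure-correct ρ M₀ f isM₀ = go (head i) M₀ f (≤-reflexive length-rows) isM₀ (λ p → p) [_]
      λ z n≤z → ⊥-elim (<⇒≱ (toℕ<n z) (subst (_≤ toℕ z) length-rows n≤z))
    where
    R⁺ = TransClosure (λ j k → T (f j k))
    go : ∀ l M g → length𝔻 l ≤ n → IsMatrix M g →
      (∀ {j k} → T (f j k) → T (g j k)) → (∀ {j k} → T (g j k) → R⁺ j k) →
      (∀ z → length𝔻 l ≤ toℕ z → ∀ {j k} → T (g j z) → T (g z k) → T (g j k)) →
      ∃[ g ] (IsMatrix (iterate (λ x r a → ⟦ tableT (tableT pivotT) ⟧ i (x ∷ r ∷ a ∷ M₀ ∷ ρ)) l M) g × ∀ j k → T (g j k) ⇔ R⁺ j k)
    go nil     M g ≤n isM incl sound trans′ = g , isM , λ j k → mk⇔ sound complete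
      where
      complete : ∀ {j k} → R⁺ j k → T (g j k)
      complete [ p ]   = incl p
      complete (p ∷ q) = trans′ _ z≤n (incl p) (complete q)
    go (x ∙ l) M g ≤n isM incl sound trans′ =
      go l _ (warshallStep p g) (<⇒≤ ≤n)
        (warshallStep-correct (M₀ ∷ ρ) x l M p (sym (toℕ-fromℕ< ≤n)) isM)
        (old ∘ incl)
        (λ q → either sound (λ where (a , b) → sound a ++⁺ sound b) (split q))
        λ z l≤z → case m≤n⇒m<n∨m≡n l≤z of λ where
          (inj₁ l<z) q q′ → through z l<z (split q) (split q′)
          (inj₂ l≡z) → pivot z (toℕ-injective (trans (toℕ-fromℕ< ≤n) l≡z))
      where
      p = fromℕ< ≤n
      g′ = warshallStep p g
      split : ∀ {j k} → T (g′ j k) → T (g j k) ⊎ (T (g j p) × T (g p k))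
      split {j} {k} q with to (T-∨ {g j k}) q
      ... | inj₁ a = inj₁ a
      ... | inj₂ b = inj₂ (to T-∧ b)
      old : ∀ {j k} → T (g j k) → T (g′ j k)
      old {j} {k} a = from (T-∨ {g j k}) (inj₁ a)
      new : ∀ {j k} → T (g j p) → T (g p k) → T (g′ j k)
      new {j} {k} a b = from (T-∨ {g j k}) (inj₂ (from T-∧ (a , b)))
      through : ∀ z → length𝔻 l < toℕ z → ∀ {j k} → T (g j z) ⊎ (T (g j p) × T (g p z)) →
                T (g z k) ⊎ (T (g z p) × T (g p k)) → T (g′ j k)
      through z l<z (inj₁ a)       (inj₁ b)       = old (trans′ z l<z a b)
      through z l<z (inj₁ a)       (inj₂ (b , c)) = new (trans′ z l<z a b) c
      through z l<z (inj₂ (a , b)) (inj₁ c)       = new a (trans′ z l<z b c)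
      through z l<z (inj₂ (a , b)) (inj₂ (c , d)) = new a d
      -- For the new pivot, `g′ j p` already gives `g j p`, which is a conjunct of its second
      -- alternative; likewise `g′ p k` gives `g p k`.
      pivot : ∀ z → p ≡ z → ∀ {j k} → T (g′ j z) → T (g′ z k) → T (g′ j k)
      pivot z refl {j} {k} q q′ = new (either (λ a → a) proj₁ (split q)) (either (λ a → a) proj₂ (split q′))

  inclusions-correct : ∀ {m} (ρ : Vec 𝔻 m) M f → IsMatrix M f →
    IsMatrix (⟦ inclusionsT ⟧ i (M ∷ ρ)) (λ r s → does (included? f r s))
  inclusions-correct ρ M f isM = matrix-correct (allT implicationT) (M ∷ ρ) (λ r s → does (included? f r s))
    λ r s x t a x′ t′ a′ eq eq′ → trans
      (all-correct implicationT (x′ ∷ t′ ∷ a′ ∷ x ∷ t ∷ a ∷ M ∷ ρ) (λ j → T? (f r j) →-dec T? (f s j))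
        λ j x″ t″ a″ eq″ → entry r s j {x} {t} {a} {x′} {t′} {a′} {x″} a″ eq eq′ eq″)
      (cong encodeBool (does-cong (all? _) (included? f r s) (λ p → p) (λ p → p)))
    where
    entry : ∀ r s j {x t a x′ t′ a′ x″ t″} a″ → length𝔻 t ≡ toℕ r → length𝔻 t′ ≡ toℕ s → length𝔻 t″ ≡ toℕ j →
            ⟦ implicationT ⟧ i
              (x″ ∷ t″ ∷ a″ ∷ x′ ∷ t′ ∷ a′ ∷ x ∷ t ∷ a ∷ M ∷ ρ)
            ≡ encodeBool (does (T? (f r j) →-dec T? (f s j)))
    entry r s j {x} {t} {a} {x′} {t′} {a′} {x″} {t″} a″ eq eq′ eq″
      rewrite entry-correct v10 v8 v2 (x″ ∷ t″ ∷ a″ ∷ x′ ∷ t′ ∷ a′ ∷ x ∷ t ∷ a ∷ M ∷ ρ) r j isM eq eq″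
      with f r j
    ... | true  = entry-correct v11 v6 v3 ((nil ∙ nil) ∷ x″ ∷ t″ ∷ a″ ∷ x′ ∷ t′ ∷ a′ ∷ x ∷ t ∷ a ∷ M ∷ ρ) s j isM eq′ eq″
    ... | false = refl

  count-correct : ∀ {m} (ρ : Vec 𝔻 m) P f → IsMatrix P (λ r s → does (included? f r s)) →
    ∃[ K ] (length𝔻 (⟦ countT ⟧ i (P ∷ ρ)) ≡ suc (length K) × length K ≤ n ×
            Unique K × (∀ r → r ∈ K ⇔ Counted f r))
  count-correct {m} ρ P f isP =
    let K , eq , ≤n , unique , iff = go (head i) (nil ∙ nil) [] refl (≤-reflexive length-rows) [] []
                                       (λ r n≤r → ⊥-elim (<⇒≱ (toℕ<n r) (subst (_≤ toℕ r) length-rows n≤r)))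
    in K , eq , ≤n , unique , iff
    where
    counted : 𝔻 → 𝔻 → 𝔻 → 𝔻
    counted x t a = ⟦ allT precedesT ⟧ i (x ∷ t ∷ a ∷ P ∷ ρ)
    entry : ∀ r s {x t a x′ t′} a′ → length𝔻 t ≡ toℕ r → length𝔻 t′ ≡ toℕ s →
      ⟦ precedesT ⟧ i
        (x′ ∷ t′ ∷ a′ ∷ x ∷ t ∷ a ∷ P ∷ ρ)
      ≡ encodeBool (does (included? f r s →-dec (included? f s r ×-dec (toℕ r ≤? toℕ s))))
    entry r s {x} {t} {a} {x′} {t′} a′ eq eq′
      rewrite entry-correct v7 v5 v2 (x′ ∷ t′ ∷ a′ ∷ x ∷ t ∷ a ∷ P ∷ ρ) r s isP eq eq′
      with included? f r s
    ... | no _  = refl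
    ... | yes _
      rewrite entry-correct v8 v3 v6 ((nil ∙ nil) ∷ x′ ∷ t′ ∷ a′ ∷ x ∷ t ∷ a ∷ P ∷ ρ) s r isP eq′ eq
      with included? f s r
    ... | no _  = refl
    ... | yes _ rewrite le-correct v7 v4 ((nil ∙ nil) ∷ (nil ∙ nil) ∷ x′ ∷ t′ ∷ a′ ∷ x ∷ t ∷ a ∷ P ∷ ρ) (index≤ s eq′)
                      | eq | eq′ = refl
    counted-correct : ∀ r {x t a} → length𝔻 t ≡ toℕ r → counted x t a ≡ encodeBool (does (counted? f r))
    counted-correct r {x} {t} {a} eq = trans
      (all-correct precedesT (x ∷ t ∷ a ∷ P ∷ ρ) (λ s → included? f r s →-dec (included? f s r ×-dec (toℕ r ≤? toℕ s)))
        λ s x′ t′ a′ eq′ → entry r s {x} {t} {a} {x′} a′ eq eq′)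
      (cong encodeBool (does-cong (all? _) (counted? f r) (λ p → p) (λ p → p)))
    go : ∀ l c K → length𝔻 c ≡ suc (length K) → length K + length𝔻 l ≤ n → Unique K →
         All (λ r → length𝔻 l ≤ toℕ r × Counted f r) K →
         (∀ r → length𝔻 l ≤ toℕ r → Counted f r → r ∈ K) →
      ∃[ K ] (length𝔻 (iterate (λ x t a → branch (counted x t a) (nil ∙ a) a) l c) ≡ suc (length K) × length K ≤ n ×
              Unique K × (∀ r → r ∈ K ⇔ Counted f r))
    go nil c K eq ≤n unique sound complete =
      K , eq , subst (_≤ n) (+-identityʳ _) ≤n , unique , λ r → mk⇔ (λ r∈K → proj₂ (All.lookup sound r∈K)) (complete r z≤n)
    go (x ∙ l) c K eq ≤n unique sound complete
      rewrite counted-correct (fromℕ< (≤-trans (m≤n+m _ (length K)) ≤n)) {x} {l} {c} (sym (toℕ-fromℕ< _))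
      with counted? f (fromℕ< (≤-trans (m≤n+m _ (length K)) ≤n))
    ... | yes cr = go l (nil ∙ c) (_ ∷ K) (cong suc eq) (subst (_≤ n) (+-suc _ _) ≤n)
            (All.map (λ { (l<r , _) refl → <-irrefl (sym (toℕ-fromℕ< _)) l<r }) sound ∷ unique)
            ((≤-reflexive (sym (toℕ-fromℕ< _)) , cr) ∷ All.map (λ (l<r , c) → <⇒≤ l<r , c) sound)
            λ r l≤r cr → case m≤n⇒m<n∨m≡n l≤r of λ where
              (inj₁ l<r) → there (complete r l<r cr)
              (inj₂ l≡r) → here (toℕ-injective (trans (sym l≡r) (sym (toℕ-fromℕ< _))))
    ... | no ¬cr = go l c K eq (≤-trans (+-monoʳ-≤ (length K) (n≤1+n _)) ≤n) unique
            (All.map (λ (l<r , c) → <⇒≤ l<r , c) sound)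
            λ r l≤r cr → case m≤n⇒m<n∨m≡n l≤r of λ where
              (inj₁ l<r) → complete r l<r cr
              (inj₂ l≡r) → ⊥-elim (¬cr (subst (Counted f) (toℕ-injective (trans (sym l≡r) (sym (toℕ-fromℕ< _)))) cr))

  triangularRoot-correct : ∀ {k} (ρ : Vec 𝔻 k) c m → length𝔻 c ≡ suc m → m ≤ n →
    let s = length𝔻 (⟦ triangularRootT ⟧ i (c ∷ ρ)) in
    s ≤ suc n × m < triangle s × (∀ u → u < s → triangle u ≤ m)
  triangularRoot-correct {k} ρ c m eq m≤n =
    go (nil ∙ head i) nil c (≤-reflexive (cong suc length-rows)) (inj₂ (≤-reflexive (cong suc (sym length-rows)))) eq λ _ ()
    where
    step : 𝔻 → 𝔻 → 𝔻 → 𝔻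
    step x r a = branch (tail a)
      (((nil ∙ head a) ∙ ⟦ dropT (cons nil (hd v3)) (tl v3) ⟧ i (x ∷ r ∷ a ∷ c ∷ ρ))) a
    Goal : 𝔻 → Set
    Goal t = length𝔻 t ≤ suc n × m < triangle (length𝔻 t) × (∀ u → u < length𝔻 t → triangle u ≤ m)
    -- Either the subtraction is finished or no round has been idle. In the second case `t` has
    -- reached `n + 1` when the fuel is used up, and `n≤triangle` shows that nothing is left.
    go : ∀ l t K → length𝔻 t + length𝔻 l ≤ suc n → K ≡ nil ⊎ suc n ≤ length𝔻 t + length𝔻 l →
         length𝔻 K ≡ suc m ∸ triangle (length𝔻 t) → (∀ u → u < length𝔻 t → triangle u ≤ m) →
         Goal (head (iterate step l (t ∙ K)))
    go nil t nil ≤n _ eq low = m+n≤o⇒m≤o _ ≤n , m∸n≡0⇒m≤n (sym eq) , low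
    go nil t (y ∙ K) ≤n (inj₂ n≤) eq low =
      case trans eq (m≤n⇒m∸n≡0 (≤-trans (s≤s m≤n) (≤-trans n≤ (≤-trans (≤-reflexive (+-identityʳ _)) (n≤triangle (length𝔻 t)))))) of λ ()
    go (x ∙ l) t nil ≤n _ eq low = go l t nil (≤-trans (+-monoʳ-≤ _ (n≤1+n _)) ≤n) (inj₁ refl) eq low
    go (x ∙ l) t (y ∙ K) ≤n (inj₂ n≤) eq low
      rewrite drop-correct (cons nil (hd v3)) (tl v3) (x ∷ l ∷ (t ∙ y ∙ K) ∷ c ∷ ρ)
                (m+n≤o⇒m≤o (suc (length𝔻 t)) (subst (_≤ suc n) (+-suc _ _) ≤n)) =
      go l (nil ∙ t) (drops t K) (subst (_≤ suc n) (+-suc _ _) ≤n) (inj₂ (subst (suc n ≤_) (+-suc _ _) n≤))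
        (begin
          length𝔻 (drops t K)                                     ≡⟨ length-drops (nil ∙ t) (y ∙ K) ⟩
          suc (length𝔻 K) ∸ suc (length𝔻 t)                       ≡⟨ cong (_∸ suc (length𝔻 t)) eq ⟩
          suc m ∸ triangle (length𝔻 t) ∸ suc (length𝔻 t)          ≡⟨ ∸-+-assoc (suc m) (triangle (length𝔻 t)) _ ⟩
          suc m ∸ (triangle (length𝔻 t) + suc (length𝔻 t))        ≡⟨ cong (suc m ∸_) (+-comm (triangle (length𝔻 t)) _) ⟩
          suc m ∸ triangle (suc (length𝔻 t))                      ∎)
        λ u u≤t → case m≤n⇒m<n∨m≡n (s≤s⁻¹ u≤t) of λ where
          (inj₁ u<t) → low u u<t
          (inj₂ refl) → ≮⇒≥ λ m< → case trans eq (m≤n⇒m∸n≡0 m<) of λ ()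
      where open ≡-Reasoning

  half-correct : ∀ {m} (e : Expr (suc m)) ρ → length𝔻 (eval e (i ∷ ρ)) ≤ suc n →
    length𝔻 (⟦ halfT e ⟧ i ρ) ≡ ⌈ length𝔻 (eval e (i ∷ ρ)) /2⌉
  half-correct e ρ ≤n = go (nil ∙ head i) nil (eval e (i ∷ ρ)) (subst (λ k → _ ≤ suc k) (sym length-rows) ≤n)
    where
    go : ∀ fuel o u → length𝔻 u ≤ length𝔻 fuel →
      length𝔻 (head (iterate (λ x r a → branch (tail a) ((nil ∙ head a) ∙ tail (tail (tail a))) a) fuel (o ∙ u)))
        ≡ length𝔻 o + ⌈ length𝔻 u /2⌉
    go nil        o nil           p       = sym (+-identityʳ _)
    go (_ ∙ fuel) o nil           p       = go fuel o nil z≤n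
    go (_ ∙ fuel) o (_ ∙ nil)     p       = trans (go fuel (nil ∙ o) nil z≤n) (sym (+-suc _ 0))
    go (_ ∙ fuel) o (_ ∙ _ ∙ u)   (s≤s p) = trans (go fuel (nil ∙ o) u (≤-trans (n≤1+n _) p)) (sym (+-suc _ _))

  ⌈n/2⌉≤⇒≤2* : ∀ v b → ⌈ v /2⌉ ≤ b → v ≤ 2 * b
  ⌈n/2⌉≤⇒≤2* zero          b       p       = z≤n
  ⌈n/2⌉≤⇒≤2* (suc zero)    (suc b) p       = s≤s z≤n
  ⌈n/2⌉≤⇒≤2* (suc (suc v)) (suc b) (s≤s p) =
    subst (2 + v ≤_) (sym (*-suc 2 b)) (s≤s (s≤s (⌈n/2⌉≤⇒≤2* v b p)))

  ≤2*⇒⌈n/2⌉≤ : ∀ v b → v ≤ 2 * b → ⌈ v /2⌉ ≤ b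
  ≤2*⇒⌈n/2⌉≤ zero          b       p = z≤n
  ≤2*⇒⌈n/2⌉≤ (suc zero)    (suc b) p = s≤s z≤n
  ≤2*⇒⌈n/2⌉≤ (suc (suc v)) (suc b) p =
    s≤s (≤2*⇒⌈n/2⌉≤ v b (s≤s⁻¹ (s≤s⁻¹ (subst (2 + v ≤_) (*-suc 2 b) p))))

  atMost-correct : ∀ {m} (ρ : Vec 𝔻 m) (k : Expr 1) κ u → eval k (i ∷ []) ≡ encodeℕ κ → length𝔻 u ≤ suc n →
    ⟦ atMostT k ⟧ i (u ∷ ρ) ≡ encodeBool (does (length𝔻 u ≤? κ))
  atMost-correct ρ k κ u eq ≤n rewrite eq =
    trans (go (fromℕᵇ κ) u ≤n) (cong (λ κ → encodeBool (does (length𝔻 u ≤? κ))) (toℕ-fromℕ κ))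
    where
    ρ′ = u ∷ ρ
    step : 𝔻 → 𝔻 → 𝔻 → 𝔻
    step x r a = ⟦ cond v1 (halfT (tl (tl v3))) (halfT (tl v3)) ⟧ i (x ∷ r ∷ a ∷ ρ′)
    go : ∀ b u → length𝔻 u ≤ suc n →
      branch (iterate step (encodeℕᵇ b) u) nil (nil ∙ nil) ≡ encodeBool (does (length𝔻 u ≤? toℕᵇ b))
    go zero     nil     ≤n = refl
    go zero     (_ ∙ _) ≤n = refl
    go 2[1+ b ] u       ≤n = trans (go b _ small)
        (cong encodeBool (does-cong (length𝔻 u′ ≤? toℕᵇ b) (length𝔻 u ≤? toℕᵇ 2[1+ b ])
          (λ p → subst (length𝔻 u ≤_) (sym (*-suc 2 (toℕᵇ b)))
                   (m∸n≤o⇒m≤n+o′ 2 (⌈n/2⌉≤⇒≤2* _ _ (subst (_≤ toℕᵇ b) len p))))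
          (λ p → subst (_≤ toℕᵇ b) (sym len)
                   (≤2*⇒⌈n/2⌉≤ _ _ (m≤n+o⇒m∸n≤o (length𝔻 u) 2 (subst (length𝔻 u ≤_) (*-suc 2 (toℕᵇ b)) p))))))
      where
      u′ = step (nil ∙ nil) (encodeℕᵇ b) u
      len₂ : length𝔻 (tail (tail u)) ≡ length𝔻 u ∸ 2
      len₂ = length-drops (nil ∙ nil ∙ nil) u
      len : length𝔻 u′ ≡ ⌈ length𝔻 u ∸ 2 /2⌉
      len = trans (half-correct (tl (tl v3)) ((nil ∙ nil) ∷ encodeℕᵇ b ∷ u ∷ ρ′)
              (subst (_≤ suc n) (sym len₂) (≤-trans (m∸n≤m _ 2) ≤n))) (cong ⌈_/2⌉ len₂)
      small : length𝔻 u′ ≤ suc n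
      small = subst (_≤ suc n) (sym len) (≤-trans (⌈n/2⌉≤n _) (≤-trans (m∸n≤m _ 2) ≤n))
      m∸n≤o⇒m≤n+o′ : ∀ k {m o} → m ∸ k ≤ o → m ≤ k + o
      m∸n≤o⇒m≤n+o′ k {m} p = ≤-trans (m≤n+m∸n m k) (+-monoʳ-≤ k p)
    go 1+[2 b ] u       ≤n = trans (go b _ small)
        (cong encodeBool (does-cong (length𝔻 u′ ≤? toℕᵇ b) (length𝔻 u ≤? toℕᵇ 1+[2 b ])
          (λ p → ≤-trans (m≤n+m∸n (length𝔻 u) 1) (+-monoʳ-≤ 1 (⌈n/2⌉≤⇒≤2* _ _ (subst (_≤ toℕᵇ b) len p))))
          (λ p → subst (_≤ toℕᵇ b) (sym len) (≤2*⇒⌈n/2⌉≤ _ _ (m≤n+o⇒m∸n≤o (length𝔻 u) 1 p)))))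
      where
      u′ = step nil (encodeℕᵇ b) u
      len₁ : length𝔻 (tail u) ≡ length𝔻 u ∸ 1
      len₁ = length-drops (nil ∙ nil) u
      len : length𝔻 u′ ≡ ⌈ length𝔻 u ∸ 1 /2⌉
      len = trans (half-correct (tl v3) (nil ∷ encodeℕᵇ b ∷ u ∷ ρ′)
              (subst (_≤ suc n) (sym len₁) (≤-trans (m∸n≤m _ 1) ≤n))) (cong ⌈_/2⌉ len₁)
      small : length𝔻 u′ ≤ suc n
      small = subst (_≤ suc n) (sym len) (≤-trans (⌈n/2⌉≤n _) (≤-trans (m∸n≤m _ 1) ≤n))

  opaque
    -- The interface to the graph theory: `K` and `s` are passed on by their characteristic
    -- properties alone, without reference to the program.
    decide-correct : ∀ (M : Tm 0) (k : Expr 1) (f : Fin n → Fin n → Bool) κ →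
      IsMatrix (⟦ M ⟧ i []) f → eval k (i ∷ []) ≡ encodeℕ κ →
      ∃[ K ] ∃[ s ] (Unique K × (∀ r → r ∈ K ⇔ Counted f r) ×
        length K < triangle s × (∀ u → u < s → triangle u ≤ length K) ×
        ⟦ decideT M k ⟧ i [] ≡ encodeBool (does (s ≤? 2 * κ)))
    decide-correct M k f κ isM eqk =
      let ρ₁ = ⟦ M ⟧ i [] ∷ []
          ρ₂ = ⟦ inclusionsT ⟧ i ρ₁ ∷ ρ₁
          ρ₃ = ⟦ countT ⟧ i ρ₂ ∷ ρ₂
          ρ₄ = ⟦ triangularRootT ⟧ i ρ₃ ∷ ρ₃
          K , eqK , K≤n , unique , counted = count-correct ρ₁ _ f (inclusions-correct [] _ f isM)
          s≤n , K< , low = triangularRoot-correct ρ₂ _ (length K) eqK K≤n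
          s = length𝔻 (⟦ triangularRootT ⟧ i ρ₃)
          len = half-correct v1 ρ₄ s≤n
      in K , s , unique , counted , K< , low ,
         trans (atMost-correct ρ₄ k κ (⟦ halfT v1 ⟧ i ρ₄) eqk (subst (_≤ suc n) (sym len) (≤-trans (⌈n/2⌉≤n s) s≤n)))
           (cong encodeBool (does-cong (_ ≤? κ) (s ≤? 2 * κ)
             (λ p → ⌈n/2⌉≤⇒≤2* s κ (subst (_≤ κ) len p))
             (λ p → subst (_≤ κ) (sym len) (≤2*⇒⌈n/2⌉≤ s κ p))))

-- Walks, paths and trees

unique-⊆⇒length≤ : ∀ {A : Set} {xs ys : List A} → Unique xs → (∀ {x} → x ∈ xs → x ∈ ys) → length xs ≤ length ys
unique-⊆⇒length≤ [] sub = z≤n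
unique-⊆⇒length≤ {xs = x ∷ xs} (x∉ ∷ u) sub with ∈-∃++ (sub (here refl))
... | as , bs , refl = begin
    suc (length xs)              ≤⟨ s≤s (unique-⊆⇒length≤ u others) ⟩
    suc (length (as ++ bs))      ≡⟨ cong suc (length-++ as) ⟩
    suc (length as + length bs)  ≡⟨ +-suc (length as) (length bs) ⟨
    length as + length (x ∷ bs)  ≡⟨ length-++ as ⟨
    length (as ++ x ∷ bs)        ∎
  where
  open ≤-Reasoning
  others : ∀ {y} → y ∈ xs → y ∈ as ++ bs
  others y∈ with ∈-++⁻ as (sub (there y∈))
  ... | inj₁ y∈as         = ∈-++⁺ˡ y∈as
  ... | inj₂ (here refl)  = ⊥-elim (All.lookup x∉ y∈ refl)
  ... | inj₂ (there y∈bs) = ∈-++⁺ʳ as y∈bs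

module Walks (G : Graph) where
  open Graph G hiding (sym)

  adj-sym : ∀ {u v} → Adj u v → Adj v u
  adj-sym {u} {v} = subst T (Graph.sym G u v)

  adj-irrefl : ∀ {u v} → Adj u v → u ≢ v
  adj-irrefl {u} a refl = subst T (irrefl u) a

  -- With membership in a subset as `P` this unfolds to `AdjIn`. Conditions are attached to steps,
  -- so an empty walk says nothing about its vertex.
  Within : (V → Set) → V → V → Set
  Within P u v = P u × P v × Adj u v

  Avoiding : V → V → V → Set
  Avoiding x = Within (_≢ x)

  ConnectedIn : (V → Set) → Set
  ConnectedIn P = ∀ {u v} → P u → P v → Star (Within P) u v

  within-map : ∀ {P Q : V → Set} → (∀ {x} → P x → Q x) → ∀ {u v} → Star (Within P) u v → Star (Within Q) u v
  within-map f = Star.map λ (p , q , a) → f p , f q , a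

  within-reverse : ∀ {P : V → Set} {u v} → Star (Within P) u v → Star (Within P) v u
  within-reverse = Star.reverse λ (p , q , a) → q , p , adj-sym a

  ∪-connected : ∀ {P Q : V → Set} {x} → ConnectedIn P → ConnectedIn Q → P x → Q x →
                ConnectedIn (λ y → P y ⊎ Q y)
  ∪-connected {P} {Q} {x} cp cq px qx pu pv = toX pu ◅◅ within-reverse (toX pv)
    where
    toX : ∀ {u} → P u ⊎ Q u → Star (Within λ y → P y ⊎ Q y) u x
    toX (inj₁ pu) = within-map inj₁ (cp pu px)
    toX (inj₂ qu) = within-map inj₂ (cq qu qx)

  data PathTo : V → V → List V → Set where
    stop : ∀ {x} → PathTo x x [ x ]ˡ
    step : ∀ {x y z l} → Adj x y → PathTo y z l → x ∉ l → PathTo x z (x ∷ l)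

  first∈ : ∀ {x z l} → PathTo x z l → x ∈ l
  first∈ stop         = here refl
  first∈ (step _ _ _) = here refl

  last∈ : ∀ {x z l} → PathTo x z l → z ∈ l
  last∈ stop         = here refl
  last∈ (step _ p _) = there (last∈ p)

  prepend-linked : ∀ {x y z l m} → Adj x y → PathTo y z l → Linked Adj (l ++ m) → Linked Adj (x ∷ l ++ m)
  prepend-linked a stop         L = a ∷ L
  prepend-linked a (step _ _ _) L = a ∷ L

  path-linked : ∀ {x z l} → PathTo x z l → Linked Adj l
  path-linked stop                       = [-]
  path-linked (step a stop _)            = a ∷ [-]
  path-linked (step a p@(step _ _ _) _)  = a ∷ path-linked p

  closed-linked : ∀ {x z y l} → PathTo x z l → Adj z y → Linked Adj (l ++ [ y ]ˡ)
  closed-linked stop         b = b ∷ [-]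
  closed-linked (step a p _) b = prepend-linked a p (closed-linked p b)

  path-unique : ∀ {x z l} → PathTo x z l → Unique l
  path-unique stop           = [] ∷ []
  path-unique (step _ p x∉l) = All.¬Any⇒All¬ _ x∉l ∷ path-unique p

  snoc : ∀ {x y z l} → PathTo x y l → Adj y z → z ∉ l → PathTo x z (l ++ [ z ]ˡ)
  snoc stop           b z∉ = step b stop λ { (here refl) → z∉ (here refl) }
  snoc (step a p x∉l) b z∉ = step a (snoc p b (z∉ ∘ there)) λ x∈ → case ∈-++⁻ _ x∈ of λ where
    (inj₁ x∈l)         → x∉l x∈l
    (inj₂ (here refl)) → z∉ (here refl)

  path-reverse : ∀ {x z l} → PathTo x z l →
                 ∃[ l′ ] (PathTo z x l′ × (∀ {y} → y ∈ l → y ∈ l′) × (∀ {y} → y ∈ l′ → y ∈ l))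
  path-reverse stop = _ , stop , (λ p → p) , (λ p → p)
  path-reverse (step {x} {l = l} a p x∉l) with path-reverse p
  ... | l′ , q , to , from = _ , snoc q (adj-sym a) (x∉l ∘ from) , to′ , from′
    where
    to′ : ∀ {y} → y ∈ x ∷ l → y ∈ l′ ++ [ x ]ˡ
    to′ (here refl) = last∈ (snoc q (adj-sym a) (x∉l ∘ from))
    to′ (there y∈)  = ∈-++⁺ˡ (to y∈)
    from′ : ∀ {y} → y ∈ l′ ++ [ x ]ˡ → y ∈ x ∷ l
    from′ y∈ with ∈-++⁻ l′ y∈
    ... | inj₁ y∈l′        = there (from y∈l′)
    ... | inj₂ (here refl) = here refl

  path-connected : ∀ {x z l} → PathTo x z l → ConnectedIn (_∈ l)
  path-connected p u∈ v∈ = within-reverse (fromFirst p u∈) ◅◅ fromFirst p v∈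
    where
    fromFirst : ∀ {x z l u} → PathTo x z l → u ∈ l → Star (Within (_∈ l)) x u
    fromFirst stop         (here refl) = ε
    fromFirst (step a p _) (here refl) = ε
    fromFirst (step a p _) (there u∈)  = (here refl , there (first∈ p) , a) ◅ within-map there (fromFirst p u∈)

  suffix : ∀ {P : V → Set} {x y z l} → PathTo y z l → All P l → x ∈ l → ∃[ l′ ] (PathTo x z l′ × All P l′)
  suffix p            ps       (here refl) = case p of λ where
    stop            → _ , stop , ps
    q@(step _ _ _)  → _ , q , ps
  suffix (step _ p _) (_ ∷ ps) (there x∈)  = suffix p ps x∈

  opaque
    erase : ∀ {P : V → Set} {x z} → P x → Star (Within P) x z → ∃[ l ] (PathTo x z l × All P l)
    erase px ε = _ , stop , px ∷ []
    erase {x = x} px ((_ , py , a) ◅ w) with erase py w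
    ... | l , p , ps with mem? _≟ᶠ_ x l
    ...   | yes x∈l = suffix p ps x∈l
    ...   | no  x∉l = _ , step a p x∉l , px ∷ ps

  path-length : ∀ {x z l} → PathTo x z l → length l ≤ order
  path-length {l = l} p = subst (length l ≤_) (length-tabulate {n = order} (λ x → x)) (unique-⊆⇒length≤ (path-unique p) λ _ → ∈-allFin _)

  -- An isolated node also counts as a leaf, so trimming may even remove the last node when there
  -- are no objects.
  Leaf : (V → Set) → V → Set
  Leaf H ℓ = H ℓ × (∀ {x y} → H x → H y → Adj ℓ x → Adj ℓ y → x ≡ y)

  -- A visit to `ℓ` inside the walk comes from its only neighbour and goes back to it, and so can be
  -- cut out.
  avoid-leaf : ∀ {H ℓ s t} → Leaf H ℓ → s ≢ ℓ → t ≢ ℓ → Star (Within H) s t →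
               Star (Within λ x → H x × x ≢ ℓ) s t
  avoid-leaf leaf s≢ t≢ ε = ε
  avoid-leaf {ℓ = ℓ} leaf s≢ t≢ (_◅_ {j = y} (hs , hy , a) w) with y ≟ᶠ ℓ
  ... | no y≢ = ((hs , s≢) , (hy , y≢) , a) ◅ avoid-leaf leaf y≢ t≢ w
  avoid-leaf leaf s≢ t≢ ((hs , hy , a) ◅ ε) | yes refl = ⊥-elim (t≢ refl)
  avoid-leaf leaf s≢ t≢ ((hs , hy , a) ◅ (_ , hz , b) ◅ w) | yes refl
    with refl ← proj₂ leaf hs hz (adj-sym a) b = avoid-leaf leaf s≢ t≢ w

  data Before (t r : V) : List V → Set where
    here  : ∀ {p} → r ∈ p → Before t r (t ∷ p)
    there : ∀ {x p} → Before t r p → Before t r (x ∷ p)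

  before⇒∈ : ∀ {t r p} → Before t r p → t ∈ p
  before⇒∈ (here _)  = here refl
  before⇒∈ (there b) = there (before⇒∈ b)

  before-total : ∀ {t r p} → t ∈ p → r ∈ p → t ≡ r ⊎ (Before t r p ⊎ Before r t p)
  before-total (here refl) (here refl) = inj₁ refl
  before-total (here refl) (there r∈)  = inj₂ (inj₁ (here r∈))
  before-total (there t∈)  (here refl) = inj₂ (inj₂ (here t∈))
  before-total (there t∈)  (there r∈)  = map-⊎ (λ e → e) (map-⊎ there there) (before-total t∈ r∈)

  -- t separates s from r.
  Between : V → V → V → Set
  Between s t r = s ≢ t → r ≢ t → ¬ Star (Avoiding t) s r

  between-sym : ∀ {s t r} → Between s t r → Between r t s
  between-sym b r≢ s≢ w = b s≢ r≢ (within-reverse w)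

  -- Otherwise a walk within `U` would join `s` to `r` and avoid `t`.
  between-∈ : ∀ {U s t r} → (∀ x → Dec (U x)) → ConnectedIn U → Between s t r → U s → U r → U t
  between-∈ {U} {s} {t} U? cU b us ur = decidable-stable (U? t) λ ¬ut →
    b (λ { refl → ¬ut us }) (λ { refl → ¬ut ur }) (within-map (λ { ux refl → ¬ut ux }) (cU us ur))

  -- Used for `y` in `H`: a node at which a walk from outside first arrives. In a tree it depends on
  -- `q` alone, by `entry-unique`.
  Entry : (V → Set) → V → V → Set
  Entry H q y = ∃[ z ] (¬ H z × Adj z y × Star (Within (¬_ ∘ H)) q z)

  firstEntry : ∀ {H U : V → Set} {q h} → (∀ x → Dec (H x)) → Star (Within U) q h → ¬ H q → H h →
               ∃[ y ] (U y × H y × Entry H q y)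
  firstEntry H? ε ¬hq hh = ⊥-elim (¬hq hh)
  firstEntry H? (_◅_ {j = x} (uq , ux , a) w) ¬hq hh with H? x
  ... | yes hx = x , ux , hx , _ , ¬hq , a , ε
  ... | no ¬hx with firstEntry H? w ¬hx hh
  ...   | y , uy , hy , z , ¬hz , b , w′ = y , uy , hy , z , ¬hz , b , (¬hq , ¬hx , a) ◅ w′

  -- Cuts the walk just before its first arrival at `x`.
  approach : ∀ {H : V → Set} {x y} → Star (Within H) y x → y ≢ x →
             ∃[ p ] (H p × Adj p x × Star (Avoiding x) y p)
  approach ε y≢x = ⊥-elim (y≢x refl)
  approach {x = x} (_◅_ {i = y} {j = z} (hy , hz , a) w) y≢x with z ≟ᶠ x
  ... | yes refl = y , hy , a , ε
  ... | no z≢x with approach w z≢x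
  ...   | p , hp , b , w′ = p , hp , b , (y≢x , z≢x , a) ◅ w′

-- Separation, convexity and gates in trees

module Trees (tree : Graph) (isTree : Graph.IsTree tree) where
  open Graph tree hiding (sym)
  open Walks tree

  -- After loop erasure the walk would close up to a cycle through `x`. Acyclicity enters the
  -- development through this lemma.
  neighbour-unique : ∀ {x y z} → Adj x y → Adj x z → Star (Avoiding x) y z → y ≡ z
  neighbour-unique {x} {y} {z} a b w with y ≟ᶠ z
  ... | yes y≡z = y≡z
  ... | no  y≢z with erase (adj-irrefl (adj-sym a)) w
  ...   | l , p , avoids = ⊥-elim (proj₂ isTree x l
            ( prepend-linked a p (closed-linked p (adj-sym b))
            , All.map (λ ne eq → ne (sym eq)) avoids ∷ path-unique p
            , long p))
    where
    nonempty : ∀ {y l} → PathTo y z l → 1 ≤ length l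
    nonempty stop         = s≤s z≤n
    nonempty (step _ _ _) = s≤s z≤n
    long : ∀ {l} → PathTo y z l → 2 ≤ length l
    long stop         = ⊥-elim (y≢z refl)
    long (step _ p _) = s≤s (nonempty p)

  -- It suffices to treat the neighbour just before `t`, by moving `s` along the path. A walk from
  -- there to `r` avoiding `t`, continued backwards along the path, would join both path neighbours
  -- of `t`, against `neighbour-unique`.
  linked-between : ∀ {s t r p} → Linked Adj (s ∷ p) → Unique (s ∷ p) → Before t r p → Between s t r
  linked-between {s} {t} {r} (a ∷ L) (s∉ ∷ (t∉ ∷ _)) (here r∈) s≢t r≢t w = go L r∈ t∉ s∉
    where
    along : ∀ {z bs r} → Linked Adj (z ∷ bs) → All (t ≢_) (z ∷ bs) → r ∈ z ∷ bs → Star (Avoiding t) z r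
    along L       ne                 (here refl) = ε
    along (a ∷ L) (t≢z ∷ t≢y ∷ ne) (there r∈) = ((λ e → t≢z (sym e)) , (λ e → t≢y (sym e)) , a) ◅ along L (t≢y ∷ ne) r∈
    go : ∀ {bs} → Linked Adj (t ∷ bs) → r ∈ bs → All (t ≢_) bs → All (s ≢_) (t ∷ bs) → ⊥
    go (b ∷ L) r∈ ne (_ ∷ s≢z ∷ _) = s≢z (neighbour-unique (adj-sym a) b (w ◅◅ within-reverse (along L ne r∈)))
  linked-between (a ∷ L) (s∉ ∷ u@(x∉ ∷ _)) (there b) s≢t r≢t w =
    linked-between L u b x≢t r≢t ((x≢t , s≢t , adj-sym a) ◅ w)
    where x≢t = All.lookup x∉ (before⇒∈ b)

  path-between : ∀ {s u t l} → PathTo s t l → u ∈ l → Between s u t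
  path-between stop         (here refl) s≢s = ⊥-elim (s≢s refl)
  path-between (step _ _ _) (here refl) s≢s = ⊥-elim (s≢s refl)
  path-between q@(step _ p _) (there u∈) with beforeLast p u∈
    where
    beforeLast : ∀ {y t l u} → PathTo y t l → u ∈ l → u ≡ t ⊎ Before u t l
    beforeLast stop         (here refl) = inj₁ refl
    beforeLast (step _ p _) (here refl) = inj₂ (here (last∈ p))
    beforeLast (step _ p _) (there u∈)  = map-⊎ (λ e → e) there (beforeLast p u∈)
  ... | inj₁ refl = λ _ t≢t → ⊥-elim (t≢t refl)
  ... | inj₂ b    = linked-between (path-linked q) (path-unique q) b

  -- Convexity of subtrees: every vertex of a path separates its ends.
  path-⊆ : ∀ {U : V → Set} {s t u l} → (∀ x → Dec (U x)) → ConnectedIn U → PathTo s t l → U s → U t → u ∈ l → U u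
  path-⊆ U? cU p us ut u∈ = between-∈ U? cU (path-between p u∈) us ut

  middle : ∀ {p a b c} → IsPath p → a ∈ p → b ∈ p → c ∈ p → Between a b c ⊎ (Between b a c ⊎ Between a c b)
  middle _ (here refl) (here refl) _ = inj₁ λ a≢a → ⊥-elim (a≢a refl)
  middle _ (here refl) _ (here refl) = inj₂ (inj₂ λ a≢a → ⊥-elim (a≢a refl))
  middle _ _ (here refl) (here refl) = inj₁ λ _ b≢b → ⊥-elim (b≢b refl)
  middle (L , u) (here refl) (there b∈) (there c∈) with before-total b∈ c∈
  ... | inj₁ refl     = inj₁ λ _ b≢b → ⊥-elim (b≢b refl)
  ... | inj₂ (inj₁ o) = inj₁ (linked-between L u o)
  ... | inj₂ (inj₂ o) = inj₂ (inj₂ (linked-between L u o))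
  middle (L , u) (there a∈) (here refl) (there c∈) with before-total a∈ c∈
  ... | inj₁ refl     = inj₂ (inj₁ λ _ b≢b → ⊥-elim (b≢b refl))
  ... | inj₂ (inj₁ o) = inj₂ (inj₁ (linked-between L u o))
  ... | inj₂ (inj₂ o) = inj₂ (inj₂ (between-sym (linked-between L u o)))
  middle (L , u) (there a∈) (there b∈) (here refl) with before-total a∈ b∈
  ... | inj₁ refl     = inj₁ λ b≢b → ⊥-elim (b≢b refl)
  ... | inj₂ (inj₁ o) = inj₂ (inj₁ (between-sym (linked-between L u o)))
  ... | inj₂ (inj₂ o) = inj₁ (between-sym (linked-between L u o))
  middle (L , (_ ∷ u)) (there a∈) (there b∈) (there c∈) = middle (Linked.tail L , u) a∈ b∈ c∈

  -- `s` and `t` are the first and the last node of `p` in `H`. The final conjunct carries the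
  -- induction: when a node of `H` is put in front, it shows that the other nodes of `H` precede
  -- `t`, as `linked-between` demands.
  hull : ∀ {H : V → Set} p → (∀ x → Dec (H x)) → IsPath p →
         (∀ {u} → u ∈ p → ¬ H u) ⊎
         ∃[ s ] ∃[ t ] (H s × H t × t ∈ p × (∀ {u} → u ∈ p → H u → Between s u t) × (∀ {u} → u ∈ p → H u → u ≡ t ⊎ Before u t p))
  hull [] H? _ = inj₁ λ ()
  hull (x ∷ p) H? (L , U@(_ ∷ u)) with H? x | hull p H? (Linked.tail L , u)
  ... | no ¬hx | inj₁ none = inj₁ λ { (here refl) → ¬hx ; (there u∈) → none u∈ }
  ... | yes hx | inj₁ none = inj₂ (x , x , hx , hx , here refl
      , (λ { (here refl) _ x≢x → ⊥-elim (x≢x refl) ; (there u∈) hu → ⊥-elim (none u∈ hu) })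
      , (λ { (here refl) _ → inj₁ refl ; (there u∈) hu → ⊥-elim (none u∈ hu) }))
  ... | no ¬hx | inj₂ (s , t , hs , ht , t∈ , btw , last) = inj₂ (s , t , hs , ht , there t∈
      , (λ { (here refl) hu → ⊥-elim (¬hx hu) ; (there u∈) → btw u∈ })
      , (λ { (here refl) hu → ⊥-elim (¬hx hu) ; (there u∈) hu → map-⊎ (λ e → e) there (last u∈ hu) }))
  ... | yes hx | inj₂ (s , t , hs , ht , t∈ , btw , last) = inj₂ (x , t , hx , ht , there t∈
      , (λ { (here refl) _ x≢x → ⊥-elim (x≢x refl)
           ; (there u∈) hu → case last u∈ hu of λ where
               (inj₁ refl) _ t≢t → ⊥-elim (t≢t refl)
               (inj₂ b)          → linked-between L U b })
      , (λ { (here refl) _ → inj₂ (here t∈) ; (there u∈) hu → map-⊎ (λ e → e) there (last u∈ hu) }))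

  -- If they differed, the walk from `z` through `q` and `z′` to `y′`, continued inside `H`, would
  -- join a neighbour of `y` outside `H` to one inside `H` without passing `y`.
  entry-unique : ∀ {H q y y′} → ConnectedIn H → H y → H y′ → Entry H q y → Entry H q y′ → y ≡ y′
  entry-unique {H} {y = y} {y′} cH hy hy′ (z , ¬hz , a , w) (z′ , ¬hz′ , a′ , w′) with y′ ≟ᶠ y
  ... | yes eq = sym eq
  ... | no y′≢y with approach (cH hy′ hy) y′≢y
  ...   | p , hp , b , v = ⊥-elim (¬hz (subst H (sym (neighbour-unique (adj-sym a) (adj-sym b)
            (within-map ≢-exit (within-reverse w ◅◅ w′) ◅◅ (≢-exit ¬hz′ , y′≢y , a′) ◅ v))) hp))
    where
    ≢-exit : ∀ {x} → ¬ H x → x ≢ y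
    ≢-exit ¬hx refl = ¬hx hy

  opaque
    -- If `q` lies outside `H`, walks from it within `O` and within `P` enter `H` at the same node,
    -- which then belongs to all three sets.
    helly : ∀ {H O P : V → Set} {q h h′} → (∀ x → Dec (H x)) → ConnectedIn H → ConnectedIn O → ConnectedIn P →
            O q → P q → O h → H h → P h′ → H h′ → ∃[ t ] (O t × P t × H t)
    helly {q = q} H? cH cO cP oq pq oh hh ph′ hh′ with H? q
    ... | yes hq = q , oq , pq , hq
    ... | no ¬hq with firstEntry H? (cO oq oh) ¬hq hh | firstEntry H? (cP pq ph′) ¬hq hh′
    ...   | y , oy , hy , e | y′ , py′ , hy′ , e′ with refl ← entry-unique cH hy hy′ e e′ = y , oy , py′ , hy

    -- `P` is connected and outside `H`, so all its nodes see the same entry into `H`; every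
    -- connected set that reaches `H` from `P` has to use it.
    gate : ∀ {H P : V → Set} {q h} → (∀ x → Dec (H x)) → ConnectedIn H → ConnectedIn P → (∀ {x} → P x → ¬ H x) →
           P q → H h → Σ V λ g → H g × (∀ {O : V → Set} {x y} → ConnectedIn O → O x → P x → O y → H y → O g)
    gate {H} {P} {q} {h} H? cH cP disjoint pq hh
      with firstEntry {U = λ _ → Unit} H? (Star.map (λ a → tt , tt , a) (proj₁ isTree q h)) (disjoint pq) hh
    ... | g , _ , hg , e = g , hg , λ cO ox px oy hy → gate∈ cO ox px oy hy
      where
      gate∈ : ∀ {O : V → Set} {x y} → ConnectedIn O → O x → P x → O y → H y → O g
      gate∈ {O} cO ox px oy hy with firstEntry H? (cO ox oy) (disjoint px) hy
      ... | y′ , oy′ , hy′ , z , ¬hz , a , w =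
        subst O (entry-unique cH hy′ hg (z , ¬hz , a , (within-map disjoint (cP pq px) ◅◅ w)) e) oy′

  -- Intersection graphs of subtrees have no induced cycle `P`, `U₁`, `Q`, `U₂`: both connecting
  -- sets contain the gate of `Q` as seen from `P`.
  no-four-cycle : ∀ {P Q U₁ U₂ : V → Set} {a b c d} → (∀ x → Dec (Q x)) → ConnectedIn P → ConnectedIn Q →
    ConnectedIn U₁ → ConnectedIn U₂ → (∀ {x} → P x → ¬ Q x) →
    P a → U₁ a → U₁ c → Q c → P b → U₂ b → U₂ d → Q d → ∃[ t ] (U₁ t × U₂ t)
  no-four-cycle Q? cP cQ c₁ c₂ disjoint pa a₁ c₁′ qc pb b₂ d₂ qd with gate Q? cQ cP disjoint pa qc
  ... | g , _ , through = g , through c₁ a₁ pa c₁′ qc , through c₂ b₂ pb d₂ qd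

  module Subtree {H : V → Set} (H? : ∀ x → Dec (H x)) (cH : ConnectedIn H) where

    -- Prolongs the path at its first vertex as long as possible. Length plus fuel stays at least
    -- `order`, and no path is longer than `order`.
    extend : ∀ fuel {y z l} → order ≤ length l + fuel → PathTo y z l → All H l →
      ∃[ y′ ] ∃[ l′ ] (PathTo y′ z l′ × All H l′ × (∀ {u} → u ∈ l → u ∈ l′) ×
                       (∀ {x} → H x → Adj y′ x → x ∈ l′))
    extend fuel {y} {z} {l} le p hs with any? (λ x → H? x ×-dec (T? (adj y x) ×-dec ¬? (mem? _≟ᶠ_ x l)))
    ... | no none = y , l , p , hs , (λ u∈ → u∈) , λ {x} hx a →
          decidable-stable (mem? _≟ᶠ_ x l) λ x∉ → none (x , hx , a , x∉)
    extend zero {l = l} le p hs | yes (x , hx , a , x∉) =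
      ⊥-elim (1+n≰n (≤-trans (path-length (step (adj-sym a) p x∉)) (subst (order ≤_) (+-identityʳ _) le)))
    extend (suc fuel) le p hs | yes (x , hx , a , x∉) with extend fuel (subst (order ≤_) (+-suc _ _) le) (step (adj-sym a) p x∉) (hx ∷ hs)
    ... | y′ , l′ , p′ , hs′ , sub , stuck = y′ , l′ , p′ , hs′ , sub ∘ there , stuck

    -- All neighbours of `y` in `H` lie on the rest of the path, which joins them without `y`; hence
    -- they coincide.
    stuck⇒leaf : ∀ {y z l} → PathTo y z l → All H l → (∀ {x} → H x → Adj y x → x ∈ l) → Leaf H y
    stuck⇒leaf {y} p hs stuck = All.lookup hs (first∈ p) , λ hx hx′ a a′ → onlyNext p stuck a a′ hx hx′
      where
      onlyNext : ∀ {y z l x x′} → PathTo y z l → (∀ {x} → H x → Adj y x → x ∈ l) → Adj y x → Adj y x′ → H x → H x′ → x ≡ x′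
      onlyNext p stuck a a′ hx hx′ with p | stuck hx a | stuck hx′ a′
      ... | stop         | here refl | _         = ⊥-elim (adj-irrefl a refl)
      ... | step _ _ _   | here refl | _         = ⊥-elim (adj-irrefl a refl)
      ... | step _ _ _   | there _   | here refl = ⊥-elim (adj-irrefl a′ refl)
      ... | step _ q y∉ | there x∈  | there x′∈ =
            neighbour-unique a a′ (within-map (λ { v∈ refl → y∉ v∈ }) (path-connected q x∈ x′∈))

    opaque
      -- Extend one end, reverse, extend the other. The nodes `h` and `h′` make the ends differ: a
      -- path stuck at one node would isolate that node in the connected set `H`.
      leafPath : ∀ {s t l h h′} → H h → H h′ → h ≢ h′ → PathTo s t l → All H l →
        ∃[ ℓ ] ∃[ ℓ′ ] ∃[ l′ ] (Leaf H ℓ × Leaf H ℓ′ × ℓ ≢ ℓ′ × PathTo ℓ ℓ′ l′ × All H l′ × (∀ {u} → u ∈ l → u ∈ l′))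
      leafPath {l = l} {h} {h′} hh hh′ h≢h′ p hs
        with extend order (m≤n+m _ _) p hs
      ... | ℓ , l₁ , p₁ , hs₁ , sub₁ , stuck₁ with path-reverse p₁
      ... | r , q , to , from with extend order (m≤n+m _ _) q (All.tabulate (All.lookup hs₁ ∘ from))
      ... | ℓ′ , l₂ , p₂ , hs₂ , sub₂ , stuck₂ =
        ℓ′ , ℓ , l₂ , leaf′ , stuck⇒leaf p₁ hs₁ stuck₁ , distinct (proj₁ leaf′) p₂ stuck₂ , p₂ , hs₂ , sub₂ ∘ to ∘ sub₁
        where
        leaf′ : Leaf H ℓ′
        leaf′ = stuck⇒leaf p₂ hs₂ stuck₂
        isolated : ∀ {ℓ x} → H ℓ → H x → ℓ ≢ x → (∀ {x} → H x → Adj ℓ x → x ≡ ℓ) → ⊥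
        isolated hℓ hx ℓ≢x only with cH hℓ hx
        ... | ε = ℓ≢x refl
        ... | (_ , hy , a) ◅ _ = adj-irrefl a (sym (only hy a))
        distinct : ∀ {y z l} → H y → PathTo y z l → (∀ {x} → H x → Adj y x → x ∈ l) → y ≢ z
        distinct _ (step _ p y∉) stuck refl = y∉ (last∈ p)
        distinct {y} hy stop stuck refl with h ≟ᶠ y
        ... | no h≢y   = isolated hy hh (h≢y ∘ sym) λ hx a → case stuck hx a of λ { (here e) → e }
        ... | yes refl = isolated hh hh′ h≢h′ λ hx a → case stuck hx a of λ { (here e) → e }

-- Counting the leaves that a family of paths has to reach

∈─⇒∉ : ∀ {n x} (p q : Subset n) → x ∈ˢ p ─ q → x ∉ˢ q
∈─⇒∉ (_ ∷ p) (outside ∷ q) (there x∈) (there x∈q) = ∈─⇒∉ p q x∈ x∈q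
∈─⇒∉ (_ ∷ p) (inside  ∷ q) (there x∈) (there x∈q) = ∈─⇒∉ p q x∈ x∈q

∈-⇒≢ : ∀ {n} {x y : Fin n} {p} → x ∈ˢ p - y → x ≢ y
∈-⇒≢ {y = y} {p} x∈ refl = ∈─⇒∉ p _ x∈ (x∈⁅x⁆ y)

pairs : ∀ {A : Set} → List A → List (A × A)
pairs []       = []
pairs (x ∷ xs) = map (x ,_) xs ++ pairs xs

length-pairs : ∀ {A : Set} (x : A) xs → length (pairs (x ∷ xs)) ≡ triangle (length xs)
length-pairs x []       = refl
length-pairs x (y ∷ xs) = begin
  length (map (x ,_) (y ∷ xs) ++ pairs (y ∷ xs))            ≡⟨ length-++ (map (x ,_) (y ∷ xs)) ⟩
  length (map (x ,_) (y ∷ xs)) + length (pairs (y ∷ xs))    ≡⟨ cong₂ _+_ (length-map (x ,_) (y ∷ xs)) (length-pairs y xs) ⟩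
  suc (length xs) + triangle (length xs)                    ∎
  where open ≡-Reasoning

∈-pairs⁺ : ∀ {A : Set} {x y : A} {xs} → x ∈ xs → y ∈ xs → x ≢ y → (x , y) ∈ pairs xs ⊎ (y , x) ∈ pairs xs
∈-pairs⁺ (here refl) (here refl) x≢y = ⊥-elim (x≢y refl)
∈-pairs⁺ (here refl) (there y∈)  x≢y = inj₁ (∈-++⁺ˡ (∈-map⁺ _ y∈))
∈-pairs⁺ (there x∈)  (here refl) x≢y = inj₂ (∈-++⁺ˡ (∈-map⁺ _ x∈))
∈-pairs⁺ {xs = z ∷ xs} (there x∈) (there y∈) x≢y = map-⊎ (∈-++⁺ʳ (map (z ,_) xs)) (∈-++⁺ʳ (map (z ,_) xs)) (∈-pairs⁺ x∈ y∈ x≢y)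

∈-pairs⁻ : ∀ {A : Set} {x y : A} {xs} → Unique xs → (x , y) ∈ pairs xs → x ∈ xs × y ∈ xs × x ≢ y
∈-pairs⁻ {xs = z ∷ xs} (z∉ ∷ u) p∈ with ∈-++⁻ (map (z ,_) xs) p∈
... | inj₁ p∈map with _ , y∈ , refl ← ∈-map⁻ (z ,_) p∈map = here refl , there y∈ , All.lookup z∉ y∈
... | inj₂ p∈xs with x∈ , y∈ , x≢y ← ∈-pairs⁻ u p∈xs = there x∈ , there y∈ , x≢y

OneOf : ∀ {A : Set} → A → A × A → Set
OneOf z (x , y) = z ≡ x ⊎ z ≡ y

-- Distinctness in the form needed for `representatives`: if one vertex represented two pairs, the
-- leaves of the later pair would be among those of the earlier.
pairs-distinct : ∀ {A : Set} {xs : List A} → Unique xs →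
                 AllPairs (λ p q → ¬ (OneOf (proj₁ q) p × OneOf (proj₂ q) p)) (pairs xs)
pairs-distinct [] = []
pairs-distinct {A} {x ∷ xs} (x∉ ∷ u) =
  AllPairs.++⁺ (AllPairs.map⁺ (sameFirst x∉ u)) (pairs-distinct u)
    (All.map⁺ (All.tabulate λ y∈ → All.tabulate (later y∈)))
  where
  sameFirst : ∀ {ys} → All (x ≢_) ys → Unique ys → AllPairs (λ y z → ¬ (OneOf x (x , y) × OneOf z (x , y))) ys
  sameFirst []        []       = []
  sameFirst (_ ∷ x∉) (y∉ ∷ u) = All.zipWith (λ where
      (x≢z , _) (_ , inj₁ z≡x) → x≢z (sym z≡x)
      (_ , y≢z) (_ , inj₂ z≡y) → y≢z (sym z≡y)) (x∉ , y∉)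
    ∷ sameFirst x∉ u
  later : ∀ {y q} → y ∈ xs → q ∈ pairs xs → ¬ (OneOf (proj₁ q) (x , y) × OneOf (proj₂ q) (x , y))
  later y∈ q∈ with ∈-pairs⁻ u q∈
  ... | z∈ , z′∈ , z≢z′ = λ where
    (inj₁ refl , _)         → All.lookup x∉ z∈ refl
    (_ , inj₁ refl)         → All.lookup x∉ z′∈ refl
    (inj₂ refl , inj₂ refl) → z≢z′ refl

all-split : ∀ {A : Set} {P Q : A → Set} {xs} → Unique xs → All (λ x → P x ⊎ Q x) xs →
  ∃[ ys ] ∃[ zs ] (length xs ≡ length ys + length zs × Unique ys × Unique zs × All P ys × All Q zs ×
                   (∀ {x} → x ∈ ys → x ∈ xs) × (∀ {x} → x ∈ zs → x ∈ xs))
all-split [] [] = [] , [] , refl , [] , [] , [] , [] , (λ ()) , (λ ())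
all-split (x∉ ∷ u) (pq ∷ pqs) with all-split u pqs
... | ys , zs , eq , uy , uz , py , qz , y⊆ , z⊆ with pq
... | inj₁ p = _ ∷ ys , zs , cong suc eq , All.tabulate (λ y∈ → All.lookup x∉ (y⊆ y∈)) ∷ uy , uz , p ∷ py , qz
             , (λ { (here e) → here e ; (there y∈) → there (y⊆ y∈) }) , there ∘ z⊆
... | inj₂ q = ys , _ ∷ zs , trans (cong suc eq) (sym (+-suc _ _)) , uy , All.tabulate (λ z∈ → All.lookup x∉ (z⊆ z∈)) ∷ uz , py , q ∷ qz
             , there ∘ y⊆ , (λ { (here e) → here e ; (there z∈) → there (z⊆ z∈) })

-- P v is the path of the vertex v, and the connected sets O i are the objects to be met.
module PathSystem
  (tree : Graph) (isTree : Graph.IsTree tree) {n : ℕ}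
  (P : Fin n → Subset (Graph.order tree))
  (P-nonempty : ∀ v → Nonempty (P v))
  (P-connected : ∀ v → Walks.ConnectedIn tree (_∈ˢ P v))
  (P-path : ∀ v → Graph.IsSubpath tree (P v))
  (I : Set) (search : ∀ {Q : I → Set} → (∀ i → Dec (Q i)) → Dec (∃ Q))
  (O : I → Graph.V tree → Set) (O? : ∀ i x → Dec (O i x))
  (O-nonempty : ∀ i → ∃ (O i)) (O-connected : ∀ i → Walks.ConnectedIn tree (O i))
  where

  open Graph tree hiding (sym)
  open Walks tree
  open Trees tree isTree

  Touches : Fin n → I → Set
  Touches v i = ∃[ x ] (x ∈ˢ P v × O i x)

  Hits : Subset order → I → Set
  Hits H i = ∃[ x ] (x ∈ˢ H × O i x)

  hits? : ∀ H i → Dec (Hits H i)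
  hits? H i = any? λ x → (x ∈ˢ? H) ×-dec O? i x

  Private : Subset order → I → V → Set
  Private H i ℓ = O i ℓ × (∀ {x} → x ∈ˢ H → O i x → x ≡ ℓ)

  leaf? : ∀ (H : Subset order) ℓ → Dec (Leaf (_∈ˢ H) ℓ)
  leaf? H ℓ = (ℓ ∈ˢ? H) ×-dec map′ (λ f {x} {y} → f x y) (λ f x y → f {x} {y})
    (all? λ x → all? λ y → (x ∈ˢ? H) →-dec ((y ∈ˢ? H) →-dec (T? (adj ℓ x) →-dec (T? (adj ℓ y) →-dec (x ≟ᶠ y)))))

  -- Leaves are removed as long as every object is still met.
  opaque
    trimmed : ∃[ H ] (ConnectedIn (_∈ˢ H) × (∀ i → Hits H i) ×
                      (∀ {ℓ} → Leaf (_∈ˢ H) ℓ → ∃[ i ] Private H i ℓ))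
    trimmed = trim ∣ ⊤ {order} ∣ ⊤ ≤-refl (λ {u} {v} _ _ → Star.map (λ a → ∈ˢ⊤ , ∈ˢ⊤ , a) (proj₁ isTree u v))
                λ i → let x , ox = O-nonempty i in x , ∈ˢ⊤ , ox
      where
      trim : ∀ fuel (H : Subset order) → ∣ H ∣ ≤ fuel → ConnectedIn (_∈ˢ H) → (∀ i → Hits H i) →
             ∃[ H ] (ConnectedIn (_∈ˢ H) × (∀ i → Hits H i) × (∀ {ℓ} → Leaf (_∈ˢ H) ℓ → ∃[ i ] Private H i ℓ))
      trim fuel H ≤fuel cH hits
        with any? (λ ℓ → leaf? H ℓ ×-dec ¬? (search λ i → ¬? (hits? (H - ℓ) i)))
      ... | no irreducible = H , cH , hits , λ {ℓ} leaf →
            let i , missed = decidable-stable (search λ i → ¬? (hits? (H - ℓ) i)) λ none → irreducible (ℓ , leaf , none)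
                x , x∈ , ox = hits i
                only : ∀ {y} → y ∈ˢ H → O i y → y ≡ ℓ
                only {y} y∈ oy = decidable-stable (y ≟ᶠ ℓ) λ y≢ℓ → missed (y , x∈p∧x≢y⇒x∈p-y y∈ y≢ℓ , oy)
            in i , subst (O i) (only x∈ ox) ox , only
      trim zero H ≤fuel cH hits | yes (ℓ , (ℓ∈ , _) , _) = case ≤-trans (x∈p⇒∣p-x∣<∣p∣ ℓ∈) ≤fuel of λ ()
      trim (suc fuel) H ≤fuel cH hits | yes (ℓ , leaf@(ℓ∈ , _) , none) =
        trim fuel (H - ℓ) (s≤s⁻¹ (≤-trans (x∈p⇒∣p-x∣<∣p∣ ℓ∈) ≤fuel))
          (λ u∈ v∈ → within-map (λ (x∈ , x≢ℓ) → x∈p∧x≢y⇒x∈p-y x∈ x≢ℓ)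
             (avoid-leaf leaf (∈-⇒≢ {p = H} u∈) (∈-⇒≢ {p = H} v∈) (cH (p─q⊆p H _ u∈) (p─q⊆p H _ v∈))))
          λ i → decidable-stable (hits? (H - ℓ) i) λ missed → none (i , missed)

  H : Subset order
  H = proj₁ trimmed

  H? : ∀ x → Dec (x ∈ˢ H)
  H? = _∈ˢ? H

  H-connected : ConnectedIn (_∈ˢ H)
  H-connected = proj₁ (proj₂ trimmed)

  H-hits : ∀ i → Hits H i
  H-hits = proj₁ (proj₂ (proj₂ trimmed))

  privateObject : ∀ {ℓ} → Leaf (_∈ˢ H) ℓ → ∃[ i ] Private H i ℓ
  privateObject = proj₂ (proj₂ (proj₂ trimmed))

  module Spread {h h′ : V} (h∈ : h ∈ˢ H) (h′∈ : h′ ∈ˢ H) (h≢h′ : h ≢ h′)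
    (common : ∀ i j → ∃[ v ] (Touches v i × Touches v j)) where
    open Subtree H? H-connected

    IsLeaf : V → Set
    IsLeaf = Leaf (_∈ˢ H)

    -- If `P v` meets `H`, the Helly property puts a node of `O i` and `H` on `P v`, and only `ℓ`
    -- qualifies. If not, the gate of `H` lies in both objects and would equal both leaves. With a
    -- single object the second case could not be excluded.
    private∈path : ∀ {v i j ℓ ℓ′} → Private H i ℓ → ℓ ∈ˢ H → Private H j ℓ′ → ℓ′ ∈ˢ H → ℓ ≢ ℓ′ →
                   Touches v i → Touches v j → ℓ ∈ˢ P v
    private∈path {v} {i} {j} (oℓ , only) ℓ∈ (oℓ′ , only′) ℓ′∈ ℓ≢ℓ′ (x , x∈ , ox) (y , y∈ , oy)
      with any? (λ z → (z ∈ˢ? P v) ×-dec H? z)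
    ... | yes (z , z∈P , z∈H) =
          let t , ot , t∈P , t∈H = helly H? H-connected (O-connected i) (P-connected v) ox x∈ oℓ ℓ∈ z∈P z∈H
          in subst (_∈ˢ P v) (only t∈H ot) t∈P
    ... | no disjoint =
          let g , g∈ , through = gate H? H-connected (P-connected v) (λ z∈P z∈H → disjoint (_ , z∈P , z∈H)) x∈ ℓ∈
          in ⊥-elim (ℓ≢ℓ′ (trans (sym (only g∈ (through (O-connected i) ox x∈ oℓ ℓ∈)))
                                 (only′ g∈ (through (O-connected j) oy y∈ oℓ′ ℓ′∈))))

    leaf-not-between : ∀ {ℓ s t} → IsLeaf ℓ → s ∈ˢ H → t ∈ˢ H → s ≢ ℓ → t ≢ ℓ → ¬ Between s ℓ t
    leaf-not-between leaf s∈ t∈ s≢ t≢ between =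
      between s≢ t≢ (within-map proj₂ (avoid-leaf leaf s≢ t≢ (H-connected s∈ t∈)))

    -- One of three nodes on a path separates the other two, but a leaf of `H` separates no two
    -- nodes of `H`.
    two-leaves : ∀ {v a b c} → IsLeaf a → IsLeaf b → IsLeaf c → a ∈ˢ P v → b ∈ˢ P v → c ∈ˢ P v →
                 a ≢ b → a ≢ c → b ≢ c → ⊥
    two-leaves {v} la@(a∈ , _) lb@(b∈ , _) lc@(c∈ , _) a∈P b∈P c∈P a≢b a≢c b≢c
      with P-path v
    ... | p , isPath , iff with middle isPath (to (iff _) a∈P) (to (iff _) b∈P) (to (iff _) c∈P)
    ... | inj₁ between        = leaf-not-between lb a∈ c∈ a≢b (b≢c ∘ sym) between
    ... | inj₂ (inj₁ between) = leaf-not-between la b∈ c∈ (a≢b ∘ sym) (a≢c ∘ sym) between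
    ... | inj₂ (inj₂ between) = leaf-not-between lc a∈ b∈ a≢c b≢c between

    one-of-two : ∀ {v a b c} → IsLeaf a → IsLeaf b → IsLeaf c → a ∈ˢ P v → b ∈ˢ P v → c ∈ˢ P v →
                 a ≢ b → c ≡ a ⊎ c ≡ b
    one-of-two {a = a} {b} {c} la lb lc a∈ b∈ c∈ a≢b with c ≟ᶠ a | c ≟ᶠ b
    ... | yes e | _     = inj₁ e
    ... | _     | yes e = inj₂ e
    ... | no ne | no ne′ = ⊥-elim (two-leaves la lb lc a∈ b∈ c∈ a≢b (ne ∘ sym) (ne′ ∘ sym))

    path-covered : ∀ {v ℓ ℓ′ l u} → PathTo ℓ ℓ′ l → ℓ ∈ˢ P v → ℓ′ ∈ˢ P v → u ∈ l → u ∈ˢ P v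
    path-covered {v} = path-⊆ (_∈ˢ? P v) (P-connected v)

    -- If `P v` misses `H`, all touched objects pass through one gate, and any leaf path through it
    -- will do. Otherwise each touched object meets `P v` inside `H`, hence between the first and
    -- last such node, and the path joining these two is extended to leaves.
    leafPathThrough : ∀ v → ∃[ ℓ ] ∃[ ℓ′ ] ∃[ l ] (IsLeaf ℓ × IsLeaf ℓ′ × ℓ ≢ ℓ′ × PathTo ℓ ℓ′ l ×
                        (∀ {i} → Touches v i → ∃[ x ] (x ∈ l × O i x)))
    leafPathThrough v with P-path v
    ... | p , isPath , iff with hull p H? isPath
    ... | inj₁ none =
      let q , q∈ = P-nonempty v
          g , g∈ , through = gate H? H-connected (P-connected v) (none ∘ to (iff _)) q∈ h∈
          ℓ , ℓ′ , l , leaf , leaf′ , ne , path , _ , sub = leafPath h∈ h′∈ h≢h′ (stop {g}) (g∈ ∷ [])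
      in ℓ , ℓ′ , l , leaf , leaf′ , ne , path , λ {i} (x , x∈ , ox) →
         let y , y∈ , oy = H-hits i in g , sub (here refl) , through (O-connected i) ox x∈ oy y∈
    ... | inj₂ (s , t , s∈ , t∈ , t∈p , between , _) =
      let l₀ , path₀ , ⊆H = erase s∈ (H-connected s∈ t∈)
          ℓ , ℓ′ , l , leaf , leaf′ , ne , path , _ , sub = leafPath h∈ h′∈ h≢h′ path₀ ⊆H
      in ℓ , ℓ′ , l , leaf , leaf′ , ne , path , λ {i} (x , x∈ , ox) →
         let y , y∈ , oy = H-hits i
             u , ou , u∈P , u∈H = helly H? H-connected (O-connected i) (P-connected v) ox x∈ oy y∈ (from (iff _) t∈p) t∈
         in u , sub (between-∈ (λ x → mem? _≟ᶠ_ x l₀) (path-connected path₀) (between (to (iff _) u∈P) u∈H) (first∈ path₀) (last∈ path₀)) , ou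

    _⊑_ : Fin n → Fin n → Set
    v ⊑ w = ∀ {i} → Touches v i → Touches w i

    dominated : ∀ v → ∃[ ℓ ] ∃[ ℓ′ ] (IsLeaf ℓ × IsLeaf ℓ′ × ℓ ≢ ℓ′ × (∀ w → ℓ ∈ˢ P w → ℓ′ ∈ˢ P w → v ⊑ w))
    dominated v with leafPathThrough v
    ... | ℓ , ℓ′ , l , leaf , leaf′ , ne , path , cover = ℓ , ℓ′ , leaf , leaf′ , ne , λ w ℓ∈ ℓ′∈ touch →
      let x , x∈ , ox = cover touch in x , path-covered path ℓ∈ ℓ′∈ x∈ , ox

    -- Leaves and inclusion-maximal vertices

    opaque
      leaves : List V
      leaves = filter (leaf? H) (allFin order)

      leaves-unique : Unique leaves
      leaves-unique = filter⁺ (leaf? H) (allFin⁺ order)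

      leaves⁺ : ∀ {ℓ} → IsLeaf ℓ → ℓ ∈ leaves
      leaves⁺ leaf = ∈-filter⁺ (leaf? H) (∈-allFin _) leaf

      leaves⁻ : ∀ {ℓ} → ℓ ∈ leaves → IsLeaf ℓ
      leaves⁻ ℓ∈ = proj₂ (∈-filter⁻ (leaf? H) {xs = allFin order} ℓ∈)

    -- The private objects are recorded because any vertex touching both must contain both leaves,
    -- and because they witness that `vertex` touches two different objects.
    record Link (a b : V) : Set where
      field
        leaf-a    : IsLeaf a
        leaf-b    : IsLeaf b
        a≢b       : a ≢ b
        core      : List V
        path      : PathTo a b core
        vertex    : Fin n
        a∈        : a ∈ˢ P vertex
        b∈        : b ∈ˢ P vertex
        i j       : I
        i-touched : Touches vertex i
        j-touched : Touches vertex j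
        i-private : Private H i a
        j-private : Private H j b

    open Link

    opaque
      link : ∀ {a b} → IsLeaf a → IsLeaf b → a ≢ b → Link a b
      link la@(a∈H , _) lb@(b∈H , _) a≢b =
        let i , pi = privateObject la
            j , pj = privateObject lb
            v , ti , tj = common i j
            l , path , _ = erase a∈H (H-connected a∈H b∈H)
        in record { leaf-a = la ; leaf-b = lb ; a≢b = a≢b ; core = l ; path = path ; vertex = v
                  ; a∈ = private∈path pi a∈H pj b∈H a≢b ti tj
                  ; b∈ = private∈path pj b∈H pi a∈H (a≢b ∘ sym) tj ti
                  ; i = i ; j = j ; i-touched = ti ; j-touched = tj ; i-private = pi ; j-private = pj }

    Represents : V × V → Fin n → Set
    Represents (x , y) v = IsLeaf x × IsLeaf y × x ≢ y × x ∈ˢ P v × y ∈ˢ P v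

    represented-distinct : ∀ {p q v} → Represents p v → Represents q v → OneOf (proj₁ q) p × OneOf (proj₂ q) p
    represented-distinct (lx , ly , x≢y , x∈ , y∈) (lx′ , ly′ , _ , x′∈ , y′∈) =
      one-of-two lx ly lx′ x∈ y∈ x′∈ x≢y , one-of-two lx ly ly′ x∈ y∈ y′∈ x≢y

    representatives : ∀ {K : List (Fin n)} {ps} → All (λ p → ∃[ v ] (v ∈ K × Represents p v)) ps →
      AllPairs (λ p q → ¬ (OneOf (proj₁ q) p × OneOf (proj₂ q) p)) ps →
      ∃[ vs ] (length vs ≡ length ps × Unique vs × (∀ {v} → v ∈ vs → v ∈ K × ∃[ p ] (p ∈ ps × Represents p v)) ×
               (∀ {p} → p ∈ ps → ∃[ v ] (v ∈ vs × Represents p v)))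
    representatives [] [] = [] , refl , [] , (λ ()) , (λ ())
    representatives ((v , v∈K , rep) ∷ reps) (new ∷ distinct) with representatives reps distinct
    ... | vs , len , unique , sound , complete = v ∷ vs , cong suc len
        , All.tabulate (λ { w∈ refl → let _ , _ , q∈ , rep′ = sound w∈ in All.lookup new q∈ (represented-distinct rep rep′) }) ∷ unique
        , (λ { (here refl) → v∈K , _ , here refl , rep
             ; (there w∈) → let w∈K , q , q∈ , rep′ = sound w∈ in w∈K , q , there q∈ , rep′ })
        , (λ { (here refl) → v , here refl , rep ; (there q∈) → let w , w∈ , rep′ = complete q∈ in w , there w∈ , rep′ })

    opaque
      -- A vertex of `K` above the vertex of a link contains both leaves, which yields a
      -- representative for each pair; no path holds three leaves, so these are distinct. Conversely
      -- a vertex of `K` lies below every vertex containing a suitable pair of leaves, in particular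
      -- below that pair's representative, and so equals it.
      count-maximal : ∀ {K : List (Fin n)} → Unique K → (∀ {r s} → r ∈ K → s ∈ K → r ⊑ s → r ≡ s) →
                      (∀ v → ∃[ r ] (r ∈ K × v ⊑ r)) → length K ≡ length (pairs leaves)
      count-maximal {K} unique antichain cofinal
        with representatives {K} {pairs leaves} (All.tabulate λ p∈ →
               let x∈ , y∈ , x≢y = ∈-pairs⁻ leaves-unique p∈
                   L = link (leaves⁻ x∈) (leaves⁻ y∈) x≢y
                   r , r∈ , L⊑r = cofinal (vertex L)
                   ti = L⊑r (i-touched L)
                   tj = L⊑r (j-touched L)
                   lx = leaves⁻ x∈
                   ly = leaves⁻ y∈
               in r , r∈ , lx , ly , x≢y
                  , private∈path (i-private L) (proj₁ lx) (j-private L) (proj₁ ly) x≢y ti tj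
                  , private∈path (j-private L) (proj₁ ly) (i-private L) (proj₁ lx) (x≢y ∘ sym) tj ti)
               (pairs-distinct leaves-unique)
      ... | vs , len , unique-vs , sound , complete =
        trans (≤-antisym (unique-⊆⇒length≤ unique K⊆vs) (unique-⊆⇒length≤ unique-vs (proj₁ ∘ sound))) len
        where
        same : ∀ {r p} → r ∈ K → p ∈ pairs leaves → (∀ w → proj₁ p ∈ˢ P w → proj₂ p ∈ˢ P w → r ⊑ w) → r ∈ vs
        same r∈ p∈ above with complete p∈
        ... | v , v∈ , _ , _ , _ , x∈ , y∈ with refl ← antichain r∈ (proj₁ (sound v∈)) (above v x∈ y∈) = v∈
        K⊆vs : ∀ {r} → r ∈ K → r ∈ vs
        K⊆vs {r} r∈ with dominated r
        ... | ℓ , ℓ′ , leaf , leaf′ , ne , above with ∈-pairs⁺ (leaves⁺ leaf) (leaves⁺ leaf′) ne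
        ...   | inj₁ p∈ = same r∈ p∈ above
        ...   | inj₂ p∈ = same r∈ p∈ λ w y∈ x∈ → above w x∈ y∈

    -- Lower bound by private objects

    TouchesPrivate : Fin n → V → Set
    TouchesPrivate v ℓ = ∃[ i ] (Private H i ℓ × Touches v i)

    at-most-two : ∀ {v ls} → Unique ls → All IsLeaf ls → All (TouchesPrivate v) ls → length ls ≤ 2
    at-most-two {ls = []}          _ _ _ = z≤n
    at-most-two {ls = _ ∷ []}      _ _ _ = s≤s z≤n
    at-most-two {ls = _ ∷ _ ∷ []}  _ _ _ = s≤s (s≤s z≤n)
    at-most-two {ls = a ∷ b ∷ c ∷ _} ((a≢b ∷ a≢c ∷ _) ∷ (b≢c ∷ _) ∷ _) (la ∷ lb ∷ lc ∷ _)
      ((i , pi , ti) ∷ (j , pj , tj) ∷ (k , pk , tk) ∷ _) = ⊥-elim (two-leaves la lb lc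
        (private∈path pi (proj₁ la) pj (proj₁ lb) a≢b ti tj)
        (private∈path pj (proj₁ lb) pi (proj₁ la) (a≢b ∘ sym) tj ti)
        (private∈path pk (proj₁ lc) pi (proj₁ la) (a≢c ∘ sym) tk ti) a≢b a≢c b≢c)

    opaque
      -- Each vertex of `S` serves the private objects of at most two leaves; these leaves are split
      -- off vertex by vertex.
      lower : ∀ (S : List (Fin n)) → (∀ i → Any (λ v → Touches v i) S) → length leaves ≤ 2 * length S
      lower S all-touched = go S leaves-unique (All.tabulate leaves⁻) (All.tabulate λ ℓ∈ →
          let i , pi = privateObject (leaves⁻ ℓ∈) in Any.map (λ t → i , pi , t) (all-touched i))
        where
        go : ∀ S {ls} → Unique ls → All IsLeaf ls → All (λ ℓ → Any (λ v → TouchesPrivate v ℓ) S) ls → length ls ≤ 2 * length S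
        go []      {[]}    _ _ _ = z≤n
        go []      {_ ∷ _} _ _ (() ∷ _)
        go (v ∷ S) {ls} unique leaf touched with all-split unique (All.map Any.toSum touched)
        ... | as , bs , eq , ua , ub , ta , tb , a⊆ , b⊆ = begin
            length ls              ≡⟨ eq ⟩
            length as + length bs  ≤⟨ +-mono-≤ (at-most-two ua (All.tabulate (All.lookup leaf ∘ a⊆)) ta)
                                               (go S ub (All.tabulate (All.lookup leaf ∘ b⊆)) tb) ⟩
            2 + 2 * length S       ≡⟨ *-suc 2 (length S) ⟨
            2 * suc (length S)     ∎
          where open ≤-Reasoning

    -- Pairing the leaves into a connected family

    Pair : Set
    Pair = ∃[ a ] ∃[ b ] Link a b

    coreOf : Pair → List V
    coreOf (_ , _ , L) = core L

    vertexOf : Pair → Fin n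
    vertexOf (_ , _ , L) = vertex L

    Endpoint : V → Pair → Set
    Endpoint x (a , b , _) = OneOf x (a , b)

    Meets : Pair → Pair → Set
    Meets p q = ∃[ x ] (x ∈ coreOf p × x ∈ coreOf q)

    meets? : ∀ p q → Dec (Meets p q)
    meets? p q = any? λ x → mem? _≟ᶠ_ x (coreOf p) ×-dec mem? _≟ᶠ_ x (coreOf q)

    -- Connectedness in a form suited to recursion: every pair meets the root or a pair further down
    -- the list.
    data Attached (r : Pair) : List Pair → Set where
      []  : Attached r []
      _∷_ : ∀ {q qs} → Any (Meets q) (r ∷ qs) → Attached r qs → Attached r (q ∷ qs)

    -- Both new cores join `ab` to `cd`, so they meet by `no-four-cycle`; their union is then
    -- connected and contains the path between `a` and `b` by convexity. Covering `ab` matters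
    -- because other pairs may be attached to it; none is yet attached to `cd`.
    exchange : ∀ {a b c d} (ab : Link a b) (cd : Link c d) (ac : Link a c) (bd : Link b d) →
      ¬ Meets (_ , _ , ab) (_ , _ , cd) →
      Meets (_ , _ , ac) (_ , _ , bd) × (∀ {x} → x ∈ core ab → x ∈ core ac ⊎ x ∈ core bd)
    exchange ab cd ac bd disjoint
      with t , t∈ac , t∈bd ← no-four-cycle {P = _∈ core ab} {_∈ core cd} {_∈ core ac} {_∈ core bd}
             (λ x → mem? _≟ᶠ_ x (core cd)) (path-connected (path ab)) (path-connected (path cd))
             (path-connected (path ac)) (path-connected (path bd)) (λ x∈ x∈′ → disjoint (_ , x∈ , x∈′))
             (first∈ (path ab)) (first∈ (path ac)) (last∈ (path ac)) (first∈ (path cd))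
             (last∈ (path ab)) (first∈ (path bd)) (last∈ (path bd)) (last∈ (path cd))
      = (t , t∈ac , t∈bd) ,
        path-⊆ (λ x → mem? _≟ᶠ_ x (core ac) ⊎-dec mem? _≟ᶠ_ x (core bd))
          (∪-connected (path-connected (path ac)) (path-connected (path bd)) t∈ac t∈bd)
          (path ab) (inj₁ (first∈ (path ac))) (inj₂ (first∈ (path bd)))

    -- `bd` goes to the end of the list, so that every pair that met `ab` finds whichever of `ac`
    -- and `bd` it meets now as the root or further down.
    reattach : ∀ {ab ac bd : Pair} {qs} → Meets ac bd → (∀ {x} → x ∈ coreOf ab → x ∈ coreOf ac ⊎ x ∈ coreOf bd) →
               Attached ab qs → Attached ac (qs ++ [ bd ]ˡ)
    reattach (x , x∈ac , x∈bd) covers [] = here (x , x∈bd , x∈ac) ∷ []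
    reattach {ab} {ac} {bd} m covers (_∷_ {q} {qs} meets att) = move meets ∷ reattach m covers att
      where
      move : Any (Meets q) (ab ∷ qs) → Any (Meets q) (ac ∷ qs ++ [ bd ]ˡ)
      move (there p∈) = there (Any.++⁺ˡ p∈)
      move (here (x , x∈q , x∈ab)) with covers x∈ab
      ... | inj₁ x∈ac = here (x , x∈q , x∈ac)
      ... | inj₂ x∈bd = there (Any.++⁺ʳ qs (here (x , x∈q , x∈bd)))

    -- Leaves are paired two at a time.  When the new path misses the root
    -- path ab, both are replaced by ac and bd, which meet and cover ab.
    cluster : ∀ {ls} → Unique ls → All IsLeaf ls → 2 ≤ length ls →
      ∃[ a ] ∃[ b ] Σ (Link a b) λ r → ∃[ qs ] (Attached (a , b , r) qs × a ∈ ls × b ∈ ls ×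
        (∀ {x} → x ∈ ls → Any (Endpoint x) ((a , b , r) ∷ qs)) × 2 * suc (length qs) ≤ suc (length ls))
    cluster {_ ∷ []} _ _ (s≤s ())
    cluster {a ∷ b ∷ []} ((a≢b ∷ []) ∷ _) (la ∷ lb ∷ []) _ =
      a , b , link la lb a≢b , [] , [] , here refl , there (here refl) ,
      (λ { (here refl) → here (inj₁ refl) ; (there (here refl)) → here (inj₂ refl) }) , n≤1+n 2
    -- With an odd number of leaves one of them is used twice, which accounts for the `suc` in the
    -- bound.
    cluster {a ∷ b ∷ c ∷ []} ((a≢b ∷ a≢c ∷ []) ∷ _) (la ∷ lb ∷ lc ∷ []) _ =
      a , b , ab , (a , c , ac) ∷ [] , here (a , first∈ (path ac) , first∈ (path ab)) ∷ [] , here refl , there (here refl) ,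
      (λ { (here refl) → here (inj₁ refl) ; (there (here refl)) → here (inj₂ refl)
         ; (there (there (here refl))) → there (here (inj₂ refl)) }) , ≤-refl
      where
      ab = link la lb a≢b
      ac = link la lc a≢c
    cluster {c ∷ d ∷ ls@(_ ∷ _ ∷ _)} ((c≢d ∷ c∉) ∷ d∉ ∷ u) (lc ∷ ld ∷ leaf) _
      with a , b , ab , qs , att , a∈ , b∈ , covered , len ← cluster u leaf (s≤s (s≤s z≤n))
      with meets? (_ , _ , link lc ld c≢d) (_ , _ , ab)
    ... | yes m = a , b , ab , (c , d , link lc ld c≢d) ∷ qs , here m ∷ att , there (there a∈) , there (there b∈) ,
          (λ { (here refl) → there (here (inj₁ refl)) ; (there (here refl)) → there (here (inj₂ refl))
             ; (there (there x∈)) → case covered x∈ of λ { (here e) → here e ; (there e) → there (there e) } }) ,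
          subst (_≤ 3 + length ls) (sym (*-suc 2 (suc (length qs)))) (s≤s (s≤s len))
    ... | no disjoint = a , c , ac , qs ++ [ _ , _ , bd ]ˡ , reattach (proj₁ swap) (proj₂ swap) att , there (there a∈) , here refl ,
          (λ { (here refl) → here (inj₂ refl)
             ; (there (here refl)) → there (Any.++⁺ʳ qs (here (inj₂ refl)))
             ; (there (there x∈)) → case covered x∈ of λ where
                 (here (inj₁ refl)) → here (inj₁ refl)
                 (here (inj₂ refl)) → there (Any.++⁺ʳ qs (here (inj₁ refl)))
                 (there e)          → there (Any.++⁺ˡ e) }) ,
          (begin
            2 * suc (length (qs ++ [ _ , _ , bd ]ˡ))  ≡⟨ cong (λ k → 2 * suc k) (trans (length-++ qs) (+-comm (length qs) 1)) ⟩
            2 * suc (suc (length qs))                 ≡⟨ *-suc 2 (suc (length qs)) ⟩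
            2 + 2 * suc (length qs)                   ≤⟨ s≤s (s≤s len) ⟩
            3 + length ls                             ∎)
      where
      open ≤-Reasoning
      ac = link (All.lookup leaf a∈) lc λ { refl → All.lookup c∉ a∈ refl }
      bd = link (All.lookup leaf b∈) ld λ { refl → All.lookup d∉ b∈ refl }
      swap = exchange ab (link lc ld c≢d) ac bd λ (x , x∈ , x∈′) → disjoint (x , x∈′ , x∈)

    -- A common node in place of adjacency, since different pairs may have the same vertex.
    Near : List (Fin n) → Fin n → Fin n → Set
    Near S v w = v ∈ S × w ∈ S × ∃[ x ] (x ∈ˢ P v × x ∈ˢ P w)

    core⊆path : ∀ p {x} → x ∈ coreOf p → x ∈ˢ P (vertexOf p)
    core⊆path (_ , _ , L) = path-covered (path L) (a∈ L) (b∈ L)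

    toRoot : ∀ {r qs p} → Attached r qs → p ∈ r ∷ qs → Star (Near (map vertexOf (r ∷ qs))) (vertexOf p) (vertexOf r)
    toRoot att (here refl) = ε
    toRoot {r} {q ∷ qs} (m ∷ att) (there p∈) = case p∈ of λ where
        (there p∈qs) → weaken (toRoot att (there p∈qs))
        (here refl) → let p′ , p′∈ , x , x∈q , x∈p′ = find m in
          (there (here refl) , skip (∈-map⁺ vertexOf p′∈) , x , core⊆path q x∈q , core⊆path p′ x∈p′)
          ◅ weaken (toRoot att p′∈)
      where
      skip : ∀ {v} → v ∈ map vertexOf (r ∷ qs) → v ∈ map vertexOf (r ∷ q ∷ qs)
      skip (here e)   = here e
      skip (there v∈) = there (there v∈)
      weaken : ∀ {v w} → Star (Near (map vertexOf (r ∷ qs))) v w → Star (Near (map vertexOf (r ∷ q ∷ qs))) v w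
      weaken = Star.map λ (v∈ , w∈ , x) → skip v∈ , skip w∈ , x

    near-connected : ∀ S → (∀ {v w} → v ∈ S → w ∈ S → Star (Near S) v w) → ConnectedIn (λ x → Any (λ v → x ∈ˢ P v) S)
    near-connected S connected x∈ y∈ with find x∈ | find y∈
    ... | v , v∈ , x∈v | w , w∈ , y∈w = walk (connected v∈ w∈) v∈ x∈v y∈w
      where
      inside-path : ∀ {v x y} → v ∈ S → x ∈ˢ P v → y ∈ˢ P v → Star (Within (λ x → Any (λ v → x ∈ˢ P v) S)) x y
      inside-path v∈ x∈ y∈ = within-map (lose v∈) (P-connected _ x∈ y∈)
      walk : ∀ {v w x y} → Star (Near S) v w → v ∈ S → x ∈ˢ P v → y ∈ˢ P w → Star (Within (λ x → Any (λ v → x ∈ˢ P v) S)) x y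
      walk ε                             v∈ x∈ y∈ = inside-path v∈ x∈ y∈
      walk ((_ , u∈ , z , z∈ , z∈′) ◅ s) v∈ x∈ y∈ = inside-path v∈ x∈ z∈ ◅◅ walk s u∈ z∈′ y∈

    opaque
      two-exist : 2 ≤ length leaves
      two-exist with leafPath h∈ h′∈ h≢h′ stop (h∈ ∷ [])
      ... | ℓ , ℓ′ , _ , leaf , leaf′ , ne , _ =
        unique-⊆⇒length≤ {xs = ℓ ∷ ℓ′ ∷ []} ((ne ∷ []) ∷ [] ∷ []) λ where
          (here refl)         → leaves⁺ leaf
          (there (here refl)) → leaves⁺ leaf′

    -- For Steiner trees: a terminal touches only its own component, so vertices with this property
    -- lie outside `X`.
    Separates : Fin n → Set
    Separates v = ∃[ i ] ∃[ j ] (Touches v i × Touches v j × ∃[ x ] (O i x × ¬ O j x))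

    opaque
      upper : ∃[ S ] (2 * length S ≤ suc (length leaves) × (∃[ v ] v ∈ S) × (∀ {v} → v ∈ S → Separates v) ×
                      (∀ {v w} → v ∈ S → w ∈ S → Star (Near S) v w) × (∀ i → ∃[ v ] (v ∈ S × Touches v i)))
      upper with cluster leaves-unique (All.tabulate leaves⁻) two-exist
      ... | a , b , r , qs , att , _ , _ , covered , len =
        S , subst (_≤ suc (length leaves)) (cong (λ k → 2 * suc k) (sym (length-map vertexOf qs))) len ,
        (vertex r , here refl) , separates , connected , touched
        where
        S : List (Fin n)
        S = map vertexOf ((a , b , r) ∷ qs)
        separates : ∀ {v} → v ∈ S → Separates v
        separates v∈ with ∈-map⁻ vertexOf {xs = (a , b , r) ∷ qs} v∈
        ... | (_ , _ , L) , _ , refl = i L , j L , i-touched L , j-touched L , _ , proj₁ (i-private L) ,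
              λ oa → a≢b L (proj₂ (j-private L) (proj₁ (leaf-a L)) oa)
        near-sym : ∀ {v w} → Near S v w → Near S w v
        near-sym (v∈ , w∈ , x , x∈ , x∈′) = w∈ , v∈ , x , x∈′ , x∈
        connected : ∀ {v w} → v ∈ S → w ∈ S → Star (Near S) v w
        connected v∈ w∈ with ∈-map⁻ vertexOf v∈ | ∈-map⁻ vertexOf w∈
        ... | p , p∈ , refl | q , q∈ , refl = toRoot att p∈ ◅◅ Star.reverse near-sym (toRoot att q∈)
        reached : ∀ {ℓ} → IsLeaf ℓ → Any (λ v → ℓ ∈ˢ P v) S
        reached leaf with find (covered (leaves⁺ leaf))
        ... | (_ , _ , L) , p∈ , inj₁ refl = lose (∈-map⁺ vertexOf p∈) (a∈ L)
        ... | (_ , _ , L) , p∈ , inj₂ refl = lose (∈-map⁺ vertexOf p∈) (b∈ L)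
        touched : ∀ i → ∃[ v ] (v ∈ S × Touches v i)
        touched i with H-hits i
        -- The object meets `H` in `x`, which lies on a path between two leaves. The union of the
        -- chosen paths is connected and contains these leaves, hence also `x`.
        ... | x , x∈ , ox with leafPath h∈ h′∈ h≢h′ (stop {x}) (x∈ ∷ [])
        ... | ℓ , ℓ′ , l , leaf , leaf′ , _ , path , _ , sub
          with v , v∈ , x∈v ← find (path-⊆ (λ x → Any.any? (λ v → x ∈ˢ? P v) S) (near-connected S connected) path
                                     (reached leaf) (reached leaf′) (sub (here refl)))
          = v , v∈ , x , x∈v , ox

  Meeting : Set
  Meeting = ∀ i j → ∃[ x ] (O i x × O j x)

  opaque
    meeting-or-spread : Meeting ⊎ ∃[ h ] ∃[ h′ ] (h ∈ˢ H × h′ ∈ˢ H × h ≢ h′)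
    meeting-or-spread with any? (λ h → any? λ h′ → H? h ×-dec (H? h′ ×-dec ¬? (h ≟ᶠ h′)))
    ... | yes (h , h′ , p) = inj₂ (h , h′ , p)
    ... | no none = inj₁ λ i j → let x , x∈ , ox = H-hits i ; y , y∈ , oy = H-hits j in
          x , ox , subst (O j) (decidable-stable (y ≟ᶠ x) λ y≢x → none (y , x , y∈ , x∈ , y≢x)) oy

-- Path graphs of diameter two

module _ {n : ℕ} (f : Fin n → Fin n → Bool) where

  -- Inclusion with ties broken towards the smaller index. `Counted` rows are those with nothing
  -- above them, so climbing in this finite strict order reaches one.
  Above : Fin n → Fin n → Set
  Above r s = Included f r s × (¬ Included f s r ⊎ toℕ s < toℕ r)

  above? : ∀ r s → Dec (Above r s)
  above? r s = included? f r s ×-dec (¬? (included? f s r) ⊎-dec (toℕ s <? toℕ r))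

  above-isSPO : IsStrictPartialOrder _≡_ Above
  above-isSPO = record
    { isEquivalence = isEquivalence
    ; irrefl        = λ { refl (_ , inj₁ ¬r⊆r) → ¬r⊆r (λ _ x → x) ; refl (_ , inj₂ r<r) → <-irrefl refl r<r }
    ; trans         = transitive
    ; <-resp-≈      = (λ { refl x → x }) , (λ { refl x → x })
    }
    where
    transitive : ∀ {r s t} → Above r s → Above s t → Above r t
    transitive {r} {s} {t} (r⊆s , p) (s⊆t , q) = (λ j x → s⊆t j (r⊆s j x)) , strict
      where
      strict : ¬ Included f t r ⊎ toℕ t < toℕ r
      strict with included? f t r
      ... | no ¬t⊆r = inj₁ ¬t⊆r
      ... | yes t⊆r = inj₂ (case p , q of λ where
        (inj₁ ¬s⊆r , _)         → ⊥-elim (¬s⊆r λ j x → t⊆r j (s⊆t j x))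
        (_         , inj₁ ¬t⊆s) → ⊥-elim (¬t⊆s λ j x → r⊆s j (t⊆r j x))
        (inj₂ s<r  , inj₂ t<s)  → <-trans t<s s<r)

  counted-cofinal : ∀ v → ∃[ r ] (Counted f r × Included f v r)
  counted-cofinal v = go v (spo-noetherian above-isSPO v)
    where
    go : ∀ v → Acc (λ r s → Above s r) v → ∃[ r ] (Counted f r × Included f v r)
    go v (acc rec) with any? (above? v)
    ... | yes (s , above) = let r , counted , s⊆r = go s (rec above) in r , counted , λ j x → s⊆r j (proj₁ above j x)
    ... | no none = v , (λ s v⊆s → decidable-stable (included? f s v) (λ ¬s⊆v → none (s , v⊆s , inj₁ ¬s⊆v)) ,
                                   ≮⇒≥ λ s<v → none (s , v⊆s , inj₂ s<v)) , λ _ x → x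

  counted-antichain : ∀ {r s} → Counted f r → Counted f s → Included f r s → r ≡ s
  counted-antichain {r} {s} cr cs r⊆s =
    let s⊆r , r≤s = cr s r⊆s in toℕ-injective (≤-antisym r≤s (proj₂ (cs r s⊆r)))

triangle-mono : ∀ {m n} → m ≤ n → triangle m ≤ triangle n
triangle-mono z≤n       = z≤n
triangle-mono (s≤s m≤n) = +-mono-≤ (s≤s m≤n) (triangle-mono m≤n)

triangular-root : ∀ {m s L} → m < triangle s → (∀ u → u < s → triangle u ≤ m) →
                  m ≡ triangle L → s ≡ suc L
triangular-root {m} {s} {L} m< low refl with <-cmp s (suc L)
... | tri< s≤L _ _ = ⊥-elim (<⇒≱ m< (triangle-mono (s≤s⁻¹ s≤L)))
... | tri≈ _ eq _  = eq
... | tri> _ _ L<s = ⊥-elim (<⇒≱ (s≤s (m≤n+m (triangle L) L)) (low (suc L) L<s))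

-- `triangle 2` is 3. This is the case of a single node in `H`, where the answer is yes and
-- `s ≤ 2 ≤ 2 k`.
triangular-root≤2 : ∀ {m s} → (∀ u → u < s → triangle u ≤ m) → m ≤ 1 → s ≤ 2
triangular-root≤2 low m≤1 = ≮⇒≥ λ 2<s → case ≤-trans (low 2 2<s) m≤1 of λ { (s≤s ()) }

length-pairs′ : ∀ {A : Set} (xs : List A) → 2 ≤ length xs →
  ∃[ m ] (length (pairs xs) ≡ triangle m × suc m ≡ length xs)
length-pairs′ (x ∷ xs) _ = length xs , length-pairs x xs , refl

all-equal⇒length≤1 : ∀ {A : Set} {xs : List A} → Unique xs → (∀ {x y} → x ∈ xs → y ∈ xs → x ≡ y) → length xs ≤ 1
all-equal⇒length≤1 {xs = []}         _                 _  = z≤n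
all-equal⇒length≤1 {xs = _ ∷ []}     _                 _  = s≤s z≤n
all-equal⇒length≤1 {xs = x ∷ y ∷ xs} ((x≢y ∷ _) ∷ _) eq = ⊥-elim (x≢y (eq (here refl) (there (here refl))))

-- Subsets and lists

elements : ∀ {n} → Subset n → List (Fin n)
elements []            = []
elements (inside  ∷ p) = zero ∷ map suc (elements p)
elements (outside ∷ p) = map suc (elements p)

length-elements : ∀ {n} (p : Subset n) → length (elements p) ≡ ∣ p ∣
length-elements []            = refl
length-elements (inside  ∷ p) = cong suc (trans (length-map suc (elements p)) (length-elements p))
length-elements (outside ∷ p) = trans (length-map suc (elements p)) (length-elements p)

∈-elements : ∀ {n x} (p : Subset n) → x ∈ˢ p → x ∈ elements p
∈-elements (inside  ∷ p) here       = here refl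
∈-elements (inside  ∷ p) (there x∈) = there (∈-map⁺ suc (∈-elements p x∈))
∈-elements (outside ∷ p) (there x∈) = ∈-map⁺ suc (∈-elements p x∈)

∣p∪q∣≤∣p∣+∣q∣ : ∀ {n} (p q : Subset n) → ∣ p ∪ q ∣ ≤ ∣ p ∣ + ∣ q ∣
∣p∪q∣≤∣p∣+∣q∣ []            []            = z≤n
∣p∪q∣≤∣p∣+∣q∣ (inside  ∷ p) (inside  ∷ q) = s≤s (≤-trans (∣p∪q∣≤∣p∣+∣q∣ p q) (+-monoʳ-≤ ∣ p ∣ (n≤1+n ∣ q ∣)))
∣p∪q∣≤∣p∣+∣q∣ (inside  ∷ p) (outside ∷ q) = s≤s (∣p∪q∣≤∣p∣+∣q∣ p q)
∣p∪q∣≤∣p∣+∣q∣ (outside ∷ p) (inside  ∷ q) = ≤-trans (s≤s (∣p∪q∣≤∣p∣+∣q∣ p q)) (≤-reflexive (sym (+-suc ∣ p ∣ ∣ q ∣)))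
∣p∪q∣≤∣p∣+∣q∣ (outside ∷ p) (outside ∷ q) = ∣p∪q∣≤∣p∣+∣q∣ p q

fromList : ∀ {n} → List (Fin n) → Subset n
fromList []      = ∅
fromList (x ∷ l) = ⁅ x ⁆ ∪ fromList l

∣fromList∣≤ : ∀ {n} (l : List (Fin n)) → ∣ fromList l ∣ ≤ length l
∣fromList∣≤ {n} [] = ≤-reflexive (∣⊥∣≡0 n)
∣fromList∣≤ (x ∷ l) = ≤-trans (∣p∪q∣≤∣p∣+∣q∣ ⁅ x ⁆ (fromList l)) (+-mono-≤ (≤-reflexive (∣⁅x⁆∣≡1 x)) (∣fromList∣≤ l))

∈-fromList⁺ : ∀ {n} {x : Fin n} {l} → x ∈ l → x ∈ˢ fromList l
∈-fromList⁺ (here refl) = x∈p∪q⁺ (inj₁ (x∈⁅x⁆ _))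
∈-fromList⁺ (there x∈)  = x∈p∪q⁺ (inj₂ (∈-fromList⁺ x∈))

∈-fromList⁻ : ∀ {n} {x : Fin n} l → x ∈ˢ fromList l → x ∈ l
∈-fromList⁻ []      x∈ = ⊥-elim (∉⊥ x∈)
∈-fromList⁻ (y ∷ l) x∈ with x∈p∪q⁻ ⁅ y ⁆ (fromList l) x∈
... | inj₁ x∈y = here (x∈⁅y⁆⇒x≡y y x∈y)
... | inj₂ x∈l = there (∈-fromList⁻ l x∈l)

reflects-⇔ : ∀ {A B : Set} (a? : Dec A) → (A → B) → (B → A) → Reflects B (does a?)
reflects-⇔ a? f g = proof (map′ f g a?)

encodeGraph-isMatrix : ∀ G → IsMatrix (encodeGraph G) (Graph.adj G)
encodeGraph-isMatrix G i r eq j r′ eq′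
  rewrite encodeList-isVector (encodeList encodeBool) (λ u → tabulate (Graph.adj G u)) i r eq
  = encodeList-isVector encodeBool (Graph.adj G i) j r′ eq′

encodeSubset-isVector : ∀ {n} (p : Subset n) → IsVector (encodeSubset p) (encodeBool ∘ lookup p)
encodeSubset-isVector (x ∷ p) zero    nil     eq = refl
encodeSubset-isVector (x ∷ p) (suc j) (_ ∙ r) eq = encodeSubset-isVector p j r (suc-injective eq)

-- Parity absorbs the extra unit that `upper` allows for an odd number of leaves.
halve-≤ : ∀ {m k} → 2 * m ≤ suc (2 * k) → m ≤ k
halve-≤ {m} {k} p = ≮⇒≥ λ k<m → 1+n≰n (≤-trans (≤-reflexive (sym (*-suc 2 k))) (≤-trans (*-monoʳ-≤ 2 k<m) p))

closedAdj : ∀ (G : Graph) → Graph.V G → Graph.V G → Bool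
closedAdj G u v = does (u ≟ᶠ v) ∨ Graph.adj G u v

maskedAdj : ∀ (G : Graph) → Subset (Graph.order G) → Graph.V G → Graph.V G → Bool
maskedAdj G X u v = lookup X v ∧ closedAdj G u v

-- Closed adjacency as sharing a tree node

module PathGraph (G : Graph) (M : TreeModel G) (paths : ∀ u → Graph.IsSubpath (TreeModel.tree M) (TreeModel.subtree M u))
  (diameter : Graph.DiameterAtMost G 2) where
  open Graph G using (order; adj; V; Adj; AdjIn; Walk)
  open TreeModel M using (tree; isTree; subtree; isSubtree; adjacent)
  open Walks G using (adj-sym)

  Share : V → V → Set
  Share u v = ∃[ x ] (x ∈ˢ subtree u × x ∈ˢ subtree v)

  share-refl : ∀ u → Share u u
  share-refl u = let x , x∈ = proj₁ (isSubtree u) in x , x∈ , x∈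

  share-sym : ∀ {u v} → Share u v → Share v u
  share-sym (x , x∈ , x∈′) = x , x∈′ , x∈

  adj⇒share : ∀ {u v} → Adj u v → Share u v
  adj⇒share {u} {v} a with to (adjacent (Walks.adj-irrefl G a)) a
  ... | x , x∈ = x , x∈p∩q⁻ (subtree u) (subtree v) x∈

  share⇒adj : ∀ {u v} → u ≢ v → Share u v → Adj u v
  share⇒adj u≢v (x , x∈ , x∈′) = from (adjacent u≢v) (x , x∈p∩q⁺ (x∈ , x∈′))

  closedAdj⇔share : ∀ u v → T (closedAdj G u v) ⇔ Share u v
  closedAdj⇔share u v with u ≟ᶠ v
  ... | yes refl = mk⇔ (λ _ → share-refl u) _
  ... | no  u≢v  = mk⇔ adj⇒share (share⇒adj u≢v)

  -- The middle of a walk of length two, or `u` itself if the walk is shorter. The diameter bound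
  -- enters here.
  commonNeighbour : ∀ u v → ∃[ w ] (Share w u × Share w v)
  commonNeighbour u v with diameter u v
  ... | d , ((walk , refl) , _) , d≤2 = along walk d≤2
    where
    along : ∀ (w : Walk u v) → Graph.walkLength G w ≤ 2 → ∃[ w ] (Share w u × Share w v)
    along ε               _ = u , share-refl u , share-refl u
    along (a ◅ ε)         _ = u , share-refl u , adj⇒share a
    along (a ◅ b ◅ ε)     _ = _ , share-sym (adj⇒share a) , adj⇒share b
    along (_ ◅ _ ◅ _ ◅ _) (s≤s (s≤s ()))

  share-step : ∀ {U : Subset order} {u v w} → u ∈ˢ U → v ∈ˢ U → Share u v → Star (AdjIn U) v w → Star (AdjIn U) u w
  share-step {u = u} {v} u∈ v∈ share s with u ≟ᶠ v
  ... | yes refl = s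
  ... | no  u≢v  = (u∈ , v∈ , share⇒adj u≢v share) ◅ s

  module System = PathSystem tree isTree subtree (λ v → proj₁ (isSubtree v)) (λ v → proj₂ (isSubtree v)) paths

  module ConnectedDomination where
    open System V any? (λ u x → x ∈ˢ subtree u) (λ u x → x ∈ˢ? subtree u) (λ u → proj₁ (isSubtree u)) (λ u → proj₂ (isSubtree u)) public

  f : V → V → Bool
  f = closedAdj G

  -- Connected dominating sets

  module Domination (k : ℕ) (1≤k : 1 ≤ k) (K : List V) (s : ℕ) (unique : Unique K) (counted : ∀ r → r ∈ K ⇔ Counted f r)
    (K< : length K < triangle s) (low : ∀ u → u < s → triangle u ≤ length K) where
    open ConnectedDomination

    Solution : Set
    Solution = ∃[ D ] (∣ D ∣ ≤ k × (∀ v → v ∈ˢ D ⊎ ∃[ u ] (u ∈ˢ D × Adj v u)) × Graph.InducedConnected G D)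

    ⊑⇒included : ∀ {r s} → (∀ {i} → Touches r i → Touches s i) → Included f r s
    ⊑⇒included {r} {s} sub j t = from (closedAdj⇔share s j) (sub (to (closedAdj⇔share r j) t))

    included⇒⊑ : ∀ {r s} → Included f r s → ∀ {i} → Touches r i → Touches s i
    included⇒⊑ {r} {s} inc {i} t = to (closedAdj⇔share s i) (inc i (from (closedAdj⇔share r i) t))

    -- Any two vertices share a node, so every row is full.
    small : Meeting → length K ≤ 1
    small meet = all-equal⇒length≤1 unique λ {r} {s} r∈ s∈ →
      counted-antichain f (to (counted r) r∈) (to (counted s) s∈) λ j _ → from (closedAdj⇔share s j) (meet s j)

    module Spreading {h h′} (h∈ : h ∈ˢ H) (h′∈ : h′ ∈ˢ H) (h≢h′ : h ≢ h′) where
      open Spread h∈ h′∈ h≢h′ commonNeighbour public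

      s≡leaves : s ≡ length leaves
      s≡leaves with length-pairs′ leaves two-exist
      ... | m , eq , eq′ = trans (triangular-root K< low (trans (count-maximal unique
          (λ {r} {s} r∈ s∈ sub → counted-antichain f (to (counted r) r∈) (to (counted s) s∈) (⊑⇒included sub))
          (λ v → let r , cr , v⊆r = counted-cofinal f v in r , from (counted r) cr , included⇒⊑ v⊆r)) eq)) eq′

    solution : s ≤ 2 * k → Solution
    solution s≤2k with meeting-or-spread
    -- A search for any vertex at all: the graph may be empty.
    ... | inj₁ meet with any? {n = order} {P = λ v → v ≡ v} (λ v → yes refl)
    ...   | no none = ∅ , ≤-trans (≤-reflexive (∣⊥∣≡0 order)) z≤n , (λ v → ⊥-elim (none (v , refl))) , λ u∈ → ⊥-elim (∉⊥ u∈)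
    ...   | yes (v , _) = ⁅ v ⁆ , ≤-trans (≤-reflexive (∣⁅x⁆∣≡1 v)) 1≤k , dominating ,
              λ u∈ w∈ → case x∈⁅y⁆⇒x≡y v u∈ , x∈⁅y⁆⇒x≡y v w∈ of λ { (refl , refl) → ε }
      where
      dominating : ∀ u → u ∈ˢ ⁅ v ⁆ ⊎ ∃[ w ] (w ∈ˢ ⁅ v ⁆ × Adj u w)
      dominating u with u ≟ᶠ v
      ... | yes refl = inj₁ (x∈⁅x⁆ u)
      ... | no  u≢v  = inj₂ (v , x∈⁅x⁆ v , share⇒adj u≢v (meet u v))
    solution s≤2k | inj₂ (h , h′ , h∈ , h′∈ , h≢h′) with Spreading.upper h∈ h′∈ h≢h′
    ... | S , len , _ , _ , connected , touched = fromList S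
        , ≤-trans (∣fromList∣≤ S) (halve-≤ (≤-trans len (s≤s (subst (_≤ 2 * k) (Spreading.s≡leaves h∈ h′∈ h≢h′) s≤2k))))
        , dominating , λ u∈ w∈ → Star.fold (λ u w → Star (AdjIn (fromList S)) u w)
            (λ (u∈ , v∈ , share) → share-step (∈-fromList⁺ u∈) (∈-fromList⁺ v∈) share) ε
            (connected (∈-fromList⁻ S u∈) (∈-fromList⁻ S w∈))
      where
      dominating : ∀ u → u ∈ˢ fromList S ⊎ ∃[ w ] (w ∈ˢ fromList S × Adj u w)
      dominating u with touched u
      ... | v , v∈ , share with u ≟ᶠ v
      ...   | yes refl = inj₁ (∈-fromList⁺ v∈)
      ...   | no  u≢v  = inj₂ (v , ∈-fromList⁺ v∈ , share⇒adj u≢v (share-sym share))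

    bound : Solution → s ≤ 2 * k
    bound (D , ∣D∣≤k , dominating , _) with meeting-or-spread
    ... | inj₁ meet = ≤-trans (triangular-root≤2 low (small meet)) (*-monoʳ-≤ 2 1≤k)
    ... | inj₂ (h , h′ , h∈ , h′∈ , h≢h′) = begin
        s                        ≡⟨ s≡leaves ⟩
        length leaves            ≤⟨ lower (elements D) touched ⟩
        2 * length (elements D)  ≡⟨ cong (2 *_) (length-elements D) ⟩
        2 * ∣ D ∣                ≤⟨ *-monoʳ-≤ 2 ∣D∣≤k ⟩
        2 * k                    ∎
      where
      open ≤-Reasoning
      open Spreading h∈ h′∈ h≢h′
      touched : ∀ u → Any (λ v → Touches v u) (elements D)
      touched u with dominating u
      ... | inj₁ u∈           = lose (∈-elements D u∈) (share-refl u)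
      ... | inj₂ (v , v∈ , a) = lose (∈-elements D v∈) (share-sym (adj⇒share a))

  -- Components of the graph induced by the terminals

  module Terminals (X : Subset order) (g : V → V → Bool)
    (closure : ∀ u v → T (g u v) ⇔ TransClosure (λ u v → T (maskedAdj G X u v)) u v) where

    -- g u v: v is a terminal that u reaches through terminals.
    R⁺ : V → V → Set
    R⁺ = TransClosure (λ u v → T (maskedAdj G X u v))

    masked⇒∈ : ∀ {u v} → T (maskedAdj G X u v) → v ∈ˢ X
    masked⇒∈ {u} {v} m = lookup⇒[]= v X (to T-≡ (proj₁ (to (T-∧ {lookup X v}) m)))

    masked⇒share : ∀ {u v} → T (maskedAdj G X u v) → Share u v
    masked⇒share {u} {v} m = to (closedAdj⇔share u v) (proj₂ (to (T-∧ {lookup X v}) m))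

    g-base : ∀ {u v} → v ∈ˢ X → Share u v → T (g u v)
    g-base {u} {v} v∈ share =
      from (closure u v) [ from T-∧ (from T-≡ ([]=⇒lookup v∈) , from (closedAdj⇔share u v) share) ]

    g-trans : ∀ {u v w} → T (g u v) → T (g v w) → T (g u w)
    g-trans p q = from (closure _ _) (to (closure _ _) p ++⁺ to (closure _ _) q)

    g-refl : ∀ {u} → u ∈ˢ X → T (g u u)
    g-refl u∈ = g-base u∈ (share-refl _)

    g⇒∈ : ∀ {u v} → T (g u v) → v ∈ˢ X
    g⇒∈ p = last (to (closure _ _) p)
      where
      last : ∀ {u v} → R⁺ u v → v ∈ˢ X
      last [ m ]   = masked⇒∈ m
      last (_ ∷ q) = last q

    g-sym : ∀ {u v} → u ∈ˢ X → T (g u v) → T (g v u)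
    g-sym u∈ p = go u∈ (to (closure _ _) p)
      where
      go : ∀ {u v} → u ∈ˢ X → R⁺ u v → T (g v u)
      go u∈ [ m ]   = g-base u∈ (share-sym (masked⇒share m))
      go u∈ (m ∷ q) = g-trans (go (masked⇒∈ m) q) (g-base u∈ (share-sym (masked⇒share m)))

    -- `u` may lie outside `X`, so the walk through terminals begins at a terminal equal or adjacent
    -- to it.
    g⇒walk : ∀ {u v} → T (g u v) → ∃[ w ] (w ∈ˢ X × Share u w × Star (AdjIn X) w v)
    g⇒walk p = go (to (closure _ _) p)
      where
      go : ∀ {u v} → R⁺ u v → ∃[ w ] (w ∈ˢ X × Share u w × Star (AdjIn X) w v)
      go [ m ]   = _ , masked⇒∈ m , masked⇒share m , ε
      go (m ∷ q) = let w , w∈ , share , s = go q in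
        _ , masked⇒∈ m , masked⇒share m , share-step (masked⇒∈ m) w∈ share s

    g⇒connected : ∀ {u v} → u ∈ˢ X → T (g u v) → Star (AdjIn X) u v
    g⇒connected u∈ p = let w , w∈ , share , s = g⇒walk p in share-step u∈ w∈ share s

    Component : V → Graph.V tree → Set
    Component x t = ∃[ y ] (T (g x y) × t ∈ˢ subtree y)

    component-nonempty : ∀ {x} → x ∈ˢ X → ∃ (Component x)
    component-nonempty {x} x∈ = let t , t∈ = proj₁ (isSubtree x) in t , x , g-refl x∈ , t∈

    component-connected : ∀ {x} → x ∈ˢ X → Walks.ConnectedIn tree (Component x)
    component-connected {x} x∈ {t} {t′} (y , x→y , t∈) (y′ , x→y′ , t′∈) =
      Walks.within-reverse tree (toward x→y t∈) ◅◅ toward x→y′ t′∈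
      where
      Inside = Star (Walks.Within tree (Component x))
      within : ∀ {y s s′} → T (g x y) → s ∈ˢ subtree y → s′ ∈ˢ subtree y → Inside s s′
      within {y} p s∈ s′∈ = Walks.within-map tree (λ s∈ → y , p , s∈) (proj₂ (isSubtree y) s∈ s′∈)
      go : ∀ {z y s s′} → T (g x z) → R⁺ z y → s ∈ˢ subtree z → s′ ∈ˢ subtree y → Inside s s′
      go p [ m ] s∈ s′∈ = let q , q∈ , q∈′ = masked⇒share m in
        within p s∈ q∈ ◅◅ within (g-trans p (g-base (masked⇒∈ m) (masked⇒share m))) q∈′ s′∈
      go p (m ∷ r) s∈ s′∈ = let q , q∈ , q∈′ = masked⇒share m in
        within p s∈ q∈ ◅◅ go (g-trans p (g-base (masked⇒∈ m) (masked⇒share m))) r q∈′ s′∈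
      toward : ∀ {y s} → T (g x y) → s ∈ˢ subtree y → Inside (proj₁ (proj₁ (isSubtree x))) s
      toward p s∈ = go (g-refl x∈) (to (closure _ _) p) (proj₂ (proj₁ (isSubtree x))) s∈

    -- Components are indexed by their terminals, so one component may occur several times; this is
    -- why `Separates` compares objects by their nodes.
    Terminal : Set
    Terminal = Σ V (_∈ˢ X)

    search : ∀ {Q : Terminal → Set} → (∀ i → Dec (Q i)) → Dec (∃ Q)
    search {Q} Q? = map′ (λ (x , x∈ , q) → (x , x∈) , q) (λ ((x , x∈) , q) → x , x∈ , q) (any? at)
      where
      at : ∀ x → Dec (Σ (x ∈ˢ X) λ x∈ → Q (x , x∈))
      at x with x ∈ˢ? X
      ... | no x∉  = no (x∉ ∘ proj₁)
      -- Membership proofs are unique, so deciding `Q` for one of them settles it for all.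
      ... | yes x∈ = map′ (x∈ ,_) (λ (x∈′ , q) → subst (λ p → Q (x , p)) ([]=-irrelevant x∈′ x∈) q) (Q? (x , x∈))

    open System Terminal search (λ (x , _) → Component x)
      (λ (x , _) t → any? λ y → T? (g x y) ×-dec (t ∈ˢ? subtree y))
      (λ (_ , x∈) → component-nonempty x∈)
      (λ (_ , x∈) → component-connected x∈)

    touches⇒g : ∀ {v i} → Touches v i → T (g v (proj₁ i))
    touches⇒g {i = x , x∈} (t , t∈ , y , x→y , t∈′) = g-trans (g-base (g⇒∈ x→y) (t , t∈ , t∈′)) (g-sym x∈ x→y)

    g⇒touches : ∀ {v i} → T (g v (proj₁ i)) → Touches v i
    g⇒touches {v} {x , x∈} p = go (to (closure _ _) p)
      where
      go : R⁺ v x → Touches v (x , x∈)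
      go [ m ]   = let t , t∈ , t∈′ = masked⇒share m in t , t∈ , x , g-refl x∈ , t∈′
      go (m ∷ q) = let t , t∈ , t∈′ = masked⇒share m in
        t , t∈ , _ , g-sym (masked⇒∈ m) (from (closure _ _) q) , t∈′

    common : ∀ i j → ∃[ v ] (Touches v i × Touches v j)
    common (x , x∈) (y , y∈) =
      let w , (t , t∈ , t∈′) , (s , s∈ , s∈′) = commonNeighbour x y
      in w , (t , t∈ , x , g-refl x∈ , t∈′) , (s , s∈ , y , g-refl y∈ , s∈′)

    component-⊆ : ∀ {x y t} → x ∈ˢ X → T (g x y) → Component x t → Component y t
    component-⊆ x∈ x→y (z , x→z , t∈) = z , g-trans (g-sym x∈ x→y) x→z , t∈

    -- Steiner trees

    module Steiner (k : ℕ) (1≤k : 1 ≤ k) (K : List V) (s : ℕ) (unique : Unique K) (counted : ∀ r → r ∈ K ⇔ Counted g r)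
      (K< : length K < triangle s) (low : ∀ u → u < s → triangle u ≤ length K) where

      SteinerSolution : Set
      SteinerSolution = ∃[ S ] (S ⊆ˢ ∁ X × ∣ S ∣ ≤ k × Graph.InducedConnected G (S ∪ X))

      ⊑⇒included : ∀ {r s} → (∀ {i} → Touches r i → Touches s i) → Included g r s
      ⊑⇒included sub j r→j = touches⇒g {i = j , g⇒∈ r→j} (sub {j , g⇒∈ r→j} (g⇒touches {i = j , g⇒∈ r→j} r→j))

      included⇒⊑ : ∀ {r s} → Included g r s → ∀ {i} → Touches r i → Touches s i
      included⇒⊑ inc {i} t = g⇒touches {i = i} (inc (proj₁ i) (touches⇒g {i = i} t))

      meeting⇒joined : Meeting → ∀ {x y} → x ∈ˢ X → y ∈ˢ X → T (g x y)
      meeting⇒joined meet x∈ y∈ with meet (_ , x∈) (_ , y∈)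
      ... | t , (z , x→z , t∈) , (z′ , y→z′ , t∈′) =
        g-trans x→z (g-trans (g-base (g⇒∈ y→z′) (t , t∈ , t∈′)) (g-sym y∈ y→z′))

      -- With a single component every row is empty or all of `X`, so any two rows are comparable.
      small : Meeting → length K ≤ 1
      small meet = all-equal⇒length≤1 unique all-same
        where
        all-same : ∀ {r s} → r ∈ K → s ∈ K → r ≡ s
        all-same {r} {s} r∈ s∈ with any? (λ x → T? (g r x))
        ... | yes (x , r→x) = sym (counted-antichain g (to (counted s) s∈) (to (counted r) r∈)
                λ j s→j → g-trans r→x (meeting⇒joined meet (g⇒∈ r→x) (g⇒∈ s→j)))
        ... | no none = counted-antichain g (to (counted r) r∈) (to (counted s) s∈) λ j r→j → ⊥-elim (none (j , r→j))

      module Spreading {h h′} (h∈ : h ∈ˢ H) (h′∈ : h′ ∈ˢ H) (h≢h′ : h ≢ h′) where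
        open Spread h∈ h′∈ h≢h′ common public

        s≡leaves : s ≡ length leaves
        s≡leaves with length-pairs′ leaves two-exist
        ... | m , eq , eq′ = trans (triangular-root K< low (trans (count-maximal unique
            (λ {r} {s} r∈ s∈ sub → counted-antichain g (to (counted r) r∈) (to (counted s) s∈) (⊑⇒included {r} {s} λ {i} → sub {i}))
            (λ v → let r , cr , v⊆r = counted-cofinal g v in r , from (counted r) cr , λ {i} → included⇒⊑ {v} {r} v⊆r {i})) eq)) eq′

        -- A terminal touching both objects would put their terminals into one component, and the
        -- objects would have the same nodes.
        separates⇒∉ : ∀ {v} → Separates v → v ∉ˢ X
        separates⇒∉ ((x , x∈) , (y , y∈) , tx , ty , t , t∈ , t∉) v∈ =
          t∉ (component-⊆ x∈ (g-trans (g-sym v∈ (touches⇒g {i = x , x∈} tx)) (touches⇒g {i = y , y∈} ty)) t∈)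

      steinerSolution : s ≤ 2 * k → SteinerSolution
      steinerSolution s≤2k with meeting-or-spread
      ... | inj₁ meet = ∅ , (λ x∈ → ⊥-elim (∉⊥ x∈)) , ≤-trans (≤-reflexive (∣⊥∣≡0 order)) z≤n , λ u∈ v∈ →
            Star.map (λ (u∈ , v∈ , a) → x∈p∪q⁺ (inj₂ u∈) , x∈p∪q⁺ (inj₂ v∈) , a)
              (g⇒connected (terminal u∈) (meeting⇒joined meet (terminal u∈) (terminal v∈)))
        where
        terminal : ∀ {u} → u ∈ˢ ∅ ∪ X → u ∈ˢ X
        terminal u∈ with x∈p∪q⁻ ∅ X u∈
        ... | inj₁ u∈∅ = ⊥-elim (∉⊥ u∈∅)
        ... | inj₂ u∈X = u∈X
      ... | inj₂ (h , h′ , h∈ , h′∈ , h≢h′) with Spreading.upper h∈ h′∈ h≢h′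
      ...   | L , len , (root , root∈) , separates , connected , touched =
        S , (λ v∈ → x∉p⇒x∈∁p (Spreading.separates⇒∉ h∈ h′∈ h≢h′ (separates (∈-fromList⁻ L v∈))))
        , ≤-trans (∣fromList∣≤ L) (halve-≤ (≤-trans len (s≤s (subst (_≤ 2 * k) (Spreading.s≡leaves h∈ h′∈ h≢h′) s≤2k))))
        , λ u∈ v∈ → toRoot (x∈p∪q⁻ S X u∈) ◅◅ Walks.within-reverse G (toRoot (x∈p∪q⁻ S X v∈))
        where
        S : Subset order
        S = fromList L
        fromS : ∀ {v} → v ∈ L → v ∈ˢ S ∪ X
        fromS v∈ = x∈p∪q⁺ (inj₁ (∈-fromList⁺ v∈))
        fromX : ∀ {v} → v ∈ˢ X → v ∈ˢ S ∪ X
        fromX v∈ = x∈p∪q⁺ (inj₂ v∈)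
        within-S : ∀ {v} → v ∈ L → Star (AdjIn (S ∪ X)) v root
        within-S v∈ = Star.fold (Star (AdjIn (S ∪ X)))
          (λ (u∈ , v∈ , share) → share-step (fromS u∈) (fromS v∈) share) ε (connected v∈ root∈)
        toRoot : ∀ {u} → u ∈ˢ S ⊎ u ∈ˢ X → Star (AdjIn (S ∪ X)) u root
        toRoot (inj₁ u∈) = within-S (∈-fromList⁻ L u∈)
        toRoot {u} (inj₂ u∈) with touched (u , u∈)
        ... | v , v∈ , touch with g⇒walk (touches⇒g {i = u , u∈} touch)
        ...   | w , w∈ , share , walk = Walks.within-reverse G
          (share-step (fromS v∈) (fromX w∈) share (Star.map (λ (a∈ , b∈ , a) → fromX a∈ , fromX b∈ , a) walk)) ◅◅ within-S v∈

      steinerBound : SteinerSolution → s ≤ 2 * k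
      steinerBound (S , _ , ∣S∣≤k , connected) with meeting-or-spread
      ... | inj₁ meet = ≤-trans (triangular-root≤2 low (small meet)) (*-monoʳ-≤ 2 1≤k)
      ... | inj₂ (h , h′ , h∈ , h′∈ , h≢h′) = begin
          s                        ≡⟨ s≡leaves ⟩
          length leaves            ≤⟨ lower (elements S) touched ⟩
          2 * length (elements S)  ≡⟨ cong (2 *_) (length-elements S) ⟩
          2 * ∣ S ∣                ≤⟨ *-monoʳ-≤ 2 ∣S∣≤k ⟩
          2 * k                    ∎
        where
        open ≤-Reasoning
        open Spreading h∈ h′∈ h≢h′
        -- A vertex supplied by `upper` touches two different components, and `x` belongs to at most
        -- one of them.
        apart : ∀ {x} → x ∈ˢ X → ∃[ y ] (y ∈ˢ X × ¬ T (g x y))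
        apart {x} x∈ with upper
        ... | _ , _ , (v , v∈) , separates , _ with separates v∈
        ...   | (y , y∈) , (z , z∈) , _ , _ , t , t∈y , t∉z with T? (g x y)
        ...     | no x↛y  = y , y∈ , x↛y
        ...     | yes x→y = z , z∈ , λ x→z → t∉z (component-⊆ y∈ (g-trans (g-sym x∈ x→y) x→z) t∈y)
        -- The walk has to leave the component of `x`; the first vertex outside it is not a
        -- terminal, hence lies in `S`, and touches the component.
        leaving : ∀ {x u y} → x ∈ˢ X → ¬ T (g x y) → T (g x u) → Star (AdjIn (S ∪ X)) u y → ∃[ v ] (v ∈ˢ S × T (g v x))
        leaving x∈ x↛y x→u ε = ⊥-elim (x↛y x→u)
        leaving x∈ x↛y x→u ((_ , v∈ , a) ◅ w) with x∈p∪q⁻ S X v∈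
        ... | inj₁ v∈S = _ , v∈S , g-trans (g-base (g⇒∈ x→u) (share-sym (adj⇒share a))) (g-sym x∈ x→u)
        ... | inj₂ v∈X = leaving x∈ x↛y (g-trans x→u (g-base v∈X (adj⇒share a))) w
        touched : ∀ i → Any (λ v → Touches v i) (elements S)
        touched (x , x∈) with apart x∈
        ... | y , y∈ , x↛y with leaving x∈ x↛y (g-refl x∈) (connected (x∈p∪q⁺ (inj₂ x∈)) (x∈p∪q⁺ (inj₂ y∈)))
        ...   | v , v∈ , v→x = lose (∈-elements S v∈) (g⇒touches {i = x , x∈} v→x)

-- The two decision programs

diameter2 : Graph → Set
diameter2 G = UndirectedPathGraph G × Graph.DiameterAtMost G 2

dominationT : Tm 0
dominationT = decideT closedNeighbourhoodsT (tl (var zero))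

domination : PolynomialTime (ConnectedDominatingSet restrictedTo diameter2)
domination = polynomialTime dominationT λ where
  (I , (M , paths) , diameter) →
    let open ConnectedDominatingSetInstance I
        module S = Semantics (encodeGraph G ∙ encodeℕ k) order (length-encodeList (encodeList encodeBool) _)
        K , s , unique , counted , K< , low , eq = S.decide-correct closedNeighbourhoodsT (tl (var zero)) (closedAdj G) k
          (S.closedNeighbourhoods-correct (encodeGraph-isMatrix G)) refl
        open PathGraph G M paths diameter
    in does (s ≤? 2 * k) ,
       reflects-⇔ (s ≤? 2 * k) (Domination.solution k (>-nonZero⁻¹ k {{positive}}) K s unique counted K< low)
                               (Domination.bound k (>-nonZero⁻¹ k {{positive}}) K s unique counted K< low) ,
       eq

steinerMatrixT : Tm 0
steinerMatrixT = bind closedNeighbourhoodsT (bind maskT closureT)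

opaque
  steinerMatrix-correct : ∀ (G : Graph) (X : Subset (Graph.order G)) k →
    let i = encodeGraph G ∙ encodeSubset X ∙ k in
    ∃[ g ] (IsMatrix (⟦ steinerMatrixT ⟧ i []) g ×
            ∀ u v → T (g u v) ⇔ TransClosure (λ u v → T (maskedAdj G X u v)) u v)
  steinerMatrix-correct G X k =
    closure-correct (nbr ∷ []) (⟦ maskT ⟧ i (nbr ∷ [])) (maskedAdj G X)
      (mask-correct nbr (closedNeighbourhoods-correct (encodeGraph-isMatrix G)) (encodeSubset-isVector X))
    where
    i : 𝔻
    i = encodeGraph G ∙ encodeSubset X ∙ k
    nbr : 𝔻
    nbr = ⟦ closedNeighbourhoodsT ⟧ i []
    open Semantics i (Graph.order G) (length-encodeList (encodeList encodeBool) _)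

steiner : PolynomialTime (SteinerTree restrictedTo diameter2)
steiner = polynomialTime (decideT steinerMatrixT (tl (tl (var zero)))) λ where
  (I , (M , paths) , diameter) →
    let open SteinerTreeInstance I
        open PathGraph G M paths diameter
        module S = Semantics (encodeGraph G ∙ encodeSubset X ∙ encodeℕ k) order (length-encodeList (encodeList encodeBool) _)
        g , isM , closure = steinerMatrix-correct G X (encodeℕ k)
        K , s , unique , counted , K< , low , eq = S.decide-correct steinerMatrixT (tl (tl (var zero))) g k isM refl
        open Terminals X g closure
    in does (s ≤? 2 * k) ,
       reflects-⇔ (s ≤? 2 * k) (Steiner.steinerSolution k (>-nonZero⁻¹ k {{positive}}) K s unique counted K< low)
                               (Steiner.steinerBound k (>-nonZero⁻¹ k {{positive}}) K s unique counted K< low) ,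
       eq

theorem10 : let C = λ (G : Graph) → UndirectedPathGraph G × Graph.DiameterAtMost G 2 in
    PolynomialTime (SteinerTree restrictedTo C) × PolynomialTime (ConnectedDominatingSet restrictedTo C)
theorem10 = steiner , domination
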